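{- Let $q\ge5$ be an odd prime power. Then the incidence structure $(\mathcal{P}_1,\mathcal{C}_1)$ is a generalized partial geometry of grade $3$, namely a $\mathrm{PG}(q-3,q-3;\,q-5,q-4,q-3)$.
   Context: Points of the projective plane $\mathrm{PG}(2,q)$ over $\mathbb{F}_q$ are written in homogeneous coordinates, normalized so that the first nonzero coordinate is $1$. Let $e_1=(1,0,0)$, $e_2=(0,1,0)$, $e_3=(0,0,1)$. A conic (for $q$ odd) is the set of points $X=(x,y,z)$ of $\mathrm{PG}(2,q)$ with $XAX^T=0$, where $A$ is a symmetric $3\times3$ matrix over $\mathbb{F}_q$ with $\det A\ne0$ ($A$ and its nonzero scalar multiples represent the same conic). $\mathcal{P}_1$ is the set of points $P\notin\{e_1,e_2,e_3\}$ of $\mathrm{PG}(2,q)$ such that no three distinct points of $\{P,e_1,e_2,e_3\}$ are collinear; thus $\mathcal{P}_1=\{(1,x,y):x,y\in\mathbb{F}_q^*\}$. $\mathcal{C}_1$ is the set of all conics containing $e_1,e_2,e_3$; these are the conics with matrix $\begin{pmatrix} 0 & a & b \\ a & 0 & 1 \\ b & 1 & 0 \end{pmatrix}$, $a,b\in\mathbb{F}_q^*$. A point of $\mathcal{P}_1$ is incident with a conic of $\mathcal{C}_1$ if it lies on it (so, as a block, a conic $\mathcal{O}\in\mathcal{C}_1$ is regarded as the point set $\mathcal{O}\cap\mathcal{P}_1$). A generalized partial geometry of grade $r$, denoted $\mathrm{PG}(s,t;\alpha_1,\dots,\alpha_r)$, is an incidence structure $(\mathcal{P},\mathcal{B})$,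 with $\mathcal{P}$ a finite non-empty set of points and $\mathcal{B}$ a family of subsets of $\mathcal{P}$ (blocks), incidence being containment, such that: (i) any two distinct points are incident with at most one common block; (ii) each block is incident with exactly $s+1$ points; (iii) each point is incident with exactly $t+1$ blocks; (iv) for any point $P$ and block $B$ with $P\notin B$, there is $\alpha\in\{\alpha_1,\dots,\alpha_r\}$ such that exactly $\alpha$ points of $B$ are joined to $P$ (two points are joined if some block contains both); (v) for each $\alpha\in\{\alpha_1,\dots,\alpha_r\}$ there exist a point $P$ and a block $B$ with $P\notin B$ such that exactly $\alpha$ points of $B$ are joined to $P$. -}

module Defs where

open import Algebra.Bundles using (CommutativeRing)
open import Algebra.Structures using (IsCommutativeRing)
open import Data.Fin.Base using (Fin)
open import Data.List.Base using (List; []; _∷_; length)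
import Data.List.Membership.Propositional as List
import Data.List.Membership.Setoid as SetoidMembership
open import Data.List.Relation.Unary.All using (All)
import Data.List.Relation.Unary.Unique.Setoid as SetoidUnique
open import Data.Nat.Base using (ℕ; _^_; _≤_) renaming (suc to 1+)
open import Data.Nat.Divisibility using (_∣_)
open import Data.Nat.Primality using (Prime)
open import Data.Product.Base using (∃; ∃₂; _×_)
open import Data.Vec.Base using (Vec)
import Data.Vec.Functional as Vector
open Vector using (Vector)
import Data.Vec.Membership.Propositional as Vec
open import Function.Bundles using (_↔_)
open import Level using (Level; 0ℓ; _⊔_) renaming (suc to lsuc)
open import Relation.Binary.Bundles using (Setoid)
open import Relation.Binary.PropositionalEquality using (_≡_; _≢_; setoid)
open import Relation.Nullary.Negation using (¬_)
open import Relation.Unary using (Pred; _∈_; _∉_; _⊆_; _∩_; _≐_; Satisfiable)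
open import Relation.Unary.Relation.Binary.Equality using (≐-setoid)

private
  variable
    c ℓ p : Level

IsOddPrimePower : ℕ → Set
IsOddPrimePower q =
  (∃₂ λ p k → Prime p × 1 ≤ k × q ≡ p ^ k) × ¬ (2 ∣ q)

-- `HasCardinality S P n`: the elements of S satisfying P, counted up to the
-- equality of S, are exactly n in number.
record HasCardinality (S : Setoid c ℓ) (P : Pred (Setoid.Carrier S) p)
                      (n : ℕ) : Set (c ⊔ ℓ ⊔ p) where
  open SetoidMembership S renaming (_∈_ to _∈ₗ_)
  open SetoidUnique S using (Unique)
  field
    elements : List (Setoid.Carrier S)
    sound    : All P elements
    complete : ∀ {x} → P x → x ∈ₗ elements
    unique   : Unique elements
    size     : length elements ≡ n

-- The point set 𝒫 is a subset of an ambient type A, and a block is a subset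
-- of 𝒫.  Subsets of A are predicates, compared extensionally by _≐_.
module _ {A : Set} (𝒫 : Pred A 0ℓ) (ℬ : Pred (Pred A 0ℓ) ℓ) where

  Joined : A → A → Set (lsuc 0ℓ ⊔ ℓ)
  Joined P Q = ∃ λ B → B ∈ ℬ × P ∈ B × Q ∈ B

  JoinedCount : A → Pred A 0ℓ → ℕ → Set (lsuc 0ℓ ⊔ ℓ)
  JoinedCount P B α = HasCardinality (setoid A) (λ Q → Q ∈ B × Joined P Q) α

  record IsGeneralizedPartialGeometry
           (r s t : ℕ) (αs : Vec ℕ r) : Set (lsuc 0ℓ ⊔ ℓ) where
    field
      finite        : ∃ λ n → HasCardinality (setoid A) 𝒫 n
      nonempty      : Satisfiable 𝒫
      blocks⊆points : ∀ {B} → B ∈ ℬ → B ⊆ 𝒫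

      atMostOneBlock : ∀ {P Q} → P ∈ 𝒫 → Q ∈ 𝒫 → P ≢ Q →
                       ∀ {B B′} → B ∈ ℬ → B′ ∈ ℬ →
                       P ∈ B → Q ∈ B → P ∈ B′ → Q ∈ B′ → B ≐ B′

      pointsPerBlock : ∀ {B} → B ∈ ℬ → HasCardinality (setoid A) B (1+ s)

      blocksPerPoint : ∀ {P} → P ∈ 𝒫 →
                       HasCardinality (≐-setoid A 0ℓ)
                                      (λ B → B ∈ ℬ × P ∈ B) (1+ t)

      joinedCounts   : ∀ {P} → P ∈ 𝒫 → ∀ {B} → B ∈ ℬ → P ∉ B →
                       ∃ λ α → α Vec.∈ αs × JoinedCount P B α

      attained       : ∀ {α} → α Vec.∈ αs →
                       ∃₂ λ P B → P ∈ 𝒫 × B ∈ ℬ × P ∉ B × JoinedCount P B α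

record FiniteField (q : ℕ) : Set₁ where
  infixl 6 _+_
  infixl 7 _*_
  infix  8 -_
  field
    F                 : Set
    _+_ _*_           : F → F → F
    -_                : F → F
    0# 1#             : F
    isCommutativeRing : IsCommutativeRing _≡_ _+_ _*_ -_ 0# 1#
    1≢0               : 1# ≢ 0#
    inverse           : ∀ x → x ≢ 0# → ∃ λ y → x * y ≡ 1#
    enumeration       : F ↔ Fin q

  commutativeRing : CommutativeRing 0ℓ 0ℓ
  commutativeRing = record { isCommutativeRing = isCommutativeRing }

module Plane {q : ℕ} (𝔽 : FiniteField q) where

  open FiniteField 𝔽
  open import Algebra.Properties.Semiring.Sum
    (CommutativeRing.semiring commutativeRing) using (sum)

  -- Homogeneous coordinates whose first nonzero entry is 1.
  data Point : Set where
    [1∶_∶_] : F → F → Point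
    [0∶1∶_] : F → Point
    [0∶0∶1] : Point

  coords : Point → Vector F 3
  coords [1∶ y ∶ z ] = 1# Vector.∷ y  Vector.∷ z  Vector.∷ Vector.[]
  coords [0∶1∶ z ]   = 0# Vector.∷ 1# Vector.∷ z  Vector.∷ Vector.[]
  coords [0∶0∶1]     = 0# Vector.∷ 0# Vector.∷ 1# Vector.∷ Vector.[]

  e₁ e₂ e₃ : Point
  e₁ = [1∶ 0# ∶ 0# ]
  e₂ = [0∶1∶ 0# ]
  e₃ = [0∶0∶1]

  OnLine : Vector F 3 → Pred Point 0ℓ
  OnLine u X = sum (λ i → u i * coords X i) ≡ 0#

  Collinear : Point → Point → Point → Set
  Collinear X Y Z = ∃ λ (u : Vector F 3) →
    (∃ λ i → u i ≢ 0#) × OnLine u X × OnLine u Y × OnLine u Z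

  Matrix₃ : Set
  Matrix₃ = Fin 3 → Fin 3 → F

  det : Matrix₃ → F
  det a = a 0F 0F * (a 1F 1F * a 2F 2F + - (a 1F 2F * a 2F 1F))
      + - (a 0F 1F * (a 1F 0F * a 2F 2F + - (a 1F 2F * a 2F 0F)))
        +  a 0F 2F * (a 1F 0F * a 2F 1F + - (a 1F 1F * a 2F 0F))
    where
    open import Data.Fin.Patterns using (0F; 1F; 2F)

  IsSymmetric : Matrix₃ → Set
  IsSymmetric A = ∀ i j → A i j ≡ A j i

  -- X A Xᵀ = 0, with the coordinates of X as a row vector.
  Zeros : Matrix₃ → Pred Point 0ℓ
  Zeros A X = sum (λ i → sum (λ j → coords X i * A i j * coords X j)) ≡ 0#

  -- A conic is a point set, so A and its nonzero multiples give the same conic.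
  IsConic : Pred (Pred Point 0ℓ) 0ℓ
  IsConic O = ∃ λ A → IsSymmetric A × det A ≢ 0# × O ≐ Zeros A

  𝒫₁ : Pred Point 0ℓ
  𝒫₁ P = P List.∉ frame × (∀ {X Y Z} →
           X List.∈ P ∷ frame → Y List.∈ P ∷ frame → Z List.∈ P ∷ frame →
           X ≢ Y → Y ≢ Z → X ≢ Z → ¬ Collinear X Y Z)
    where
    frame : List Point
    frame = e₁ ∷ e₂ ∷ e₃ ∷ []

  𝒞₁ : Pred (Pred Point 0ℓ) 0ℓ
  𝒞₁ O = IsConic O × e₁ ∈ O × e₂ ∈ O × e₃ ∈ O

  -- A conic O in 𝒞₁ as a block is the point set O ∩ 𝒫₁.
  ℬ₁ : Pred (Pred Point 0ℓ) (lsuc 0ℓ)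
  ℬ₁ B = ∃ λ O → O ∈ 𝒞₁ × B ≐ O ∩ 𝒫₁

{-# OPTIONS --safe #-}
-- A conic through e₁, e₂, e₃ meets the torus {(1, x, y) : x, y ≠ 0} in a curve
-- a x + b y = x y with a, b ≠ 0.  Dividing by x y, its points correspond to the
-- p ≠ 0, 1 through a = p y, b = (1 - p) x, and for fixed (x, y) the same formulas
-- parametrise the conics through (1, x, y); both sets have q - 2 elements.  Two
-- points (x, y) ≠ (s, t) lie on a common conic, then unique by Cramer's rule, iff
-- x ≠ s, y ≠ t and x t ≠ s y.  For a point (x, y) off the conic (w y, z x), that is
-- w + z ≠ 1, these conditions exclude the parameters w, 1 - z and w / (w + z), which
-- are distinct and are admissible when w ≠ 1, z ≠ 1 and w + z ≠ 0 respectively.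
-- Since 2 ≠ 0 in F, at least one of them is admissible, and so q - 3, q - 4 or q - 5
-- points remain.
module Submission where

open import Defs
open import Algebra.Bundles using (CommutativeRing)
open import Data.Fin.Base using (Fin)
open import Data.Fin.Patterns using (0F; 1F; 2F; 3F)
import Data.Fin.Properties as Fin
open import Data.List.Base using (List; []; _∷_; map; allFin; _++_; cartesianProduct; lookup)
open import Data.List.Membership.Propositional using () renaming (_∈_ to _∈ₗ_)
open import Data.List.Membership.Propositional.Properties
  using (∈-∃++; ∈-allFin; ∈-map⁺; ∈-cartesianProduct⁺; ∈-cartesianProduct⁻)
open import Data.List.Properties using (length-map; length-tabulate)
open import Data.List.Relation.Binary.Permutation.Propositional using (↭-reflexive; ↭⇒↭ₛ; ↭-trans)
open import Data.List.Relation.Binary.Permutation.Propositional.Properties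
  using (shift; ∈-resp-↭; All-resp-↭; ↭-length)
import Data.List.Relation.Binary.Permutation.Setoid.Properties as Permutation
open import Data.List.Relation.Unary.All using (All; []; _∷_)
import Data.List.Relation.Unary.All as All
import Data.List.Relation.Unary.All.Properties as All
open import Data.List.Relation.Unary.AllPairs using (AllPairs; []; _∷_)
open import Data.List.Relation.Unary.Any using (here; there)
import Data.List.Relation.Unary.Any as Any
import Data.List.Relation.Unary.Any.Properties as Any
import Data.List.Relation.Unary.Unique.Propositional.Properties as Unique
import Data.Nat.Base as ℕ
open import Data.Nat.Base using (ℕ; suc; _∸_; _≤_; pred)
open import Data.Nat.Divisibility using (_∣_; m%n≡0⇒n∣m)
open import Data.Nat.DivMod using (_%_; _/_; m≡m%n+[m/n]*n; m%n<n)
import Data.Nat.Properties as ℕ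
open import Data.Product.Base using (∃; ∃₂; _×_; _,_; proj₁; proj₂)
open import Data.Sum.Base using (_⊎_; inj₁; inj₂)
open import Data.Unit.Base using (tt)
open import Data.Vec.Base using ([]; _∷_)
import Data.Vec.Functional as Vector
import Data.Vec.Membership.Propositional as Vec
open import Data.Vec.Relation.Unary.Any using (here; there)
open import Function.Base using (_∘_; id; const)
open import Function.Bundles using (_↔_; Inverse; mk↔ₛ′)
open import Function.Construct.Composition using (_↔-∘_)
open import Function.Construct.Symmetry using (↔-sym)
open import Function.Properties.Inverse using (↔⇒↣)
open import Level using (Level; 0ℓ)
open import Relation.Binary.Bundles using (Setoid)
open import Relation.Binary.Definitions using (DecidableEquality)
open import Relation.Binary.PropositionalEquality
open import Relation.Nullary using (¬_; Dec; yes; no; contradiction)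
open import Relation.Nullary.Decidable using (decidable-stable; from-yes; ¬?; _→-dec_; _⊎-dec_)
open import Relation.Unary using (Pred; _∈_; _∉_; _∩_; ∁; U; _≐_)
open import Relation.Unary.Relation.Binary.Equality using (≐-setoid)

-- Counting subsets by lists without repetition.

module Cardinality where

  private
    variable
      a c ℓ p r : Level
      A B : Set a
      P Q : Pred A p
      n k : ℕ

  Card : {A : Set a} → Pred A p → ℕ → Set _
  Card {A = A} = HasCardinality (setoid A)

  card-full : A ↔ Fin n → Card {A = A} U n
  card-full {n = n} A↔Fin = record
    { elements = map from (allFin n)
    ; sound    = All.tabulate _
    ; complete = λ {x} _ → subst (_∈ₗ map from (allFin n)) (strictlyInverseʳ x)
                                 (∈-map⁺ from (∈-allFin (to x)))
    ; unique   = Unique.map⁺ (λ {i} {j} eq →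
                   trans (sym (strictlyInverseˡ i)) (trans (cong to eq) (strictlyInverseˡ j)))
                   (Unique.allFin⁺ n)
    ; size     = trans (length-map from (allFin n)) (length-tabulate _)
    }
    where
    open Inverse A↔Fin

  card-× : Card P n → Card Q k → ∃ (Card λ (x , y) → P x × Q y)
  card-× cardP cardQ = _ , record
    { elements = cartesianProduct P.elements Q.elements
    ; sound    = All.tabulate λ xy∈ →
                   let x∈ , y∈ = ∈-cartesianProduct⁻ P.elements Q.elements xy∈
                   in All.lookup P.sound x∈ , All.lookup Q.sound y∈
    ; complete = λ (Px , Qy) → ∈-cartesianProduct⁺ (P.complete Px) (Q.complete Qy)
    ; unique   = Unique.cartesianProduct⁺ P.unique Q.unique
    ; size     = refl
    }
    where
    module P = HasCardinality cardP
    module Q = HasCardinality cardQ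

  card-nonempty : Card P (suc n) → ∃ P
  card-nonempty record { elements = x ∷ _ ; sound = Px ∷ _ } = x , Px

  -- Permuting the sole element of P with property Q to the front leaves the remainder as the tail,
  -- and the absence of repetitions keeps that element out of it. Truncated subtraction satisfies
  -- pred (n ∸ k) = n ∸ suc k unconditionally, so successive removals need no bound on k.
  card-exclude : Card P (n ∸ k) → (∃ λ x → P x × Q x × (∀ {y} → Q y → y ≡ x)) →
                 Card (P ∩ ∁ Q) (n ∸ suc k)
  card-exclude {n = n} {k = k} {Q = Q} card@record { complete = complete ; unique = unique } (x , Px , Qx , Q⇒≡)
    with ys , zs , split ← ∈-∃++ (complete Px)
    with perm ← ↭-trans (↭-reflexive split) (shift x ys zs)
    with x∉ ∷ uniq ← Permutation.Unique-resp-↭ (setoid _) (↭⇒↭ₛ perm) unique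
    = record
    { elements = ys ++ zs
    ; sound    = All.zipWith (λ (Py , x≢y) → Py , x≢y ∘ sym ∘ Q⇒≡)
                             (All.tail (All-resp-↭ perm sound) , x∉)
    ; complete = λ (Py , ¬Qy) → Any.tail (λ y≡x → ¬Qy (subst Q (sym y≡x) Qx))
                                         (∈-resp-↭ perm (complete Py))
    ; unique   = uniq
    ; size     = trans (cong pred (trans (sym (↭-length perm)) size)) (ℕ.pred[m∸n]≡m∸[1+n] n k)
    }
    where open HasCardinality card using (sound; size)

  card-keep : Card P n → (∀ {x} → P x → ¬ Q x) → Card (P ∩ ∁ Q) n
  card-keep card P⇒¬Q = record
    { elements = elements
    ; sound    = All.map (λ Px → Px , P⇒¬Q Px) sound
    ; complete = complete ∘ proj₁
    ; unique   = unique
    ; size     = size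
    }
    where open HasCardinality card

  -- It acts on the subtrahend k of a size `n ∸ k`, so `suc` here stands for one element fewer.
  decrement : Dec {a} A → ℕ → ℕ
  decrement (yes _) = suc
  decrement (no _)  = λ n → n

  -- V tells whether the value to be excluded occurs in P at all. Keeping the decision inside the
  -- size lets several exclusions be chained in one statement and postpones the case split.
  card-exclude? : {V : Set r} (V? : Dec V) → Card P (n ∸ k) →
                  (V → ∃ λ x → P x × Q x × (∀ {y} → Q y → y ≡ x)) →
                  (¬ V → ∀ {x} → P x → ¬ Q x) →
                  Card (P ∩ ∁ Q) (n ∸ decrement V? k)
  card-exclude? {n = n} {k = k} (yes v) card hit miss = card-exclude {n = n} {k = k} card (hit v)
  card-exclude? (no ¬v) card hit miss = card-keep card (miss ¬v)

  -- The target carries its own equality because points are compared by `_≡_` and blocks by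
  -- extensional equality of point sets.
  card-image : {A : Set a} {P : Pred A p} (S : Setoid c ℓ) {Q : Pred (Setoid.Carrier S) r}
               (f : A → Setoid.Carrier S) → Card P n →
               (∀ {x} → P x → Q (f x)) →
               (∀ {x y} → P x → P y → Setoid._≈_ S (f x) (f y) → x ≡ y) →
               (∀ {y} → Q y → ∃ λ x → P x × Setoid._≈_ S y (f x)) →
               HasCardinality S Q n
  card-image {A = A} {P} S f card into injective onto = record
    { elements = map f elements
    ; sound    = All.map⁺ (All.map into sound)
    ; complete = λ Qy → let x , Px , y≈fx = onto Qy in
                   Any.map⁺ (Any.map (λ x≡z → Setoid.trans S y≈fx (Setoid.reflexive S (cong f x≡z)))
                                     (complete Px))
    ; unique   = unique-map sound unique
    ; size     = trans (length-map f elements) size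
    }
    where
    open HasCardinality card
    open Setoid S using (_≈_)
    unique-map : ∀ {xs} → All P xs → AllPairs _≢_ xs → AllPairs (λ u v → ¬ u ≈ v) (map f xs)
    unique-map []         []          = []
    unique-map (Px ∷ Pxs) (x∉ ∷ uniq) =
      All.map⁺ (All.zipWith (λ (Py , x≢y) fx≈fy → x≢y (injective Px Py fx≈fy)) (Pxs , x∉))
      ∷ unique-map Pxs uniq

open Cardinality

-- Arithmetic in a finite field.

module FieldProperties {q : ℕ} (𝔽 : FiniteField q) where
  open FiniteField 𝔽
  open CommutativeRing commutativeRing public
    using (+-comm; *-comm; +-assoc; +-identityˡ; +-identityʳ; *-identityˡ; *-identityʳ;
           zeroˡ; zeroʳ; -‿inverseˡ; -‿inverseʳ; distribˡ)
  open import Algebra.Properties.Group (CommutativeRing.+-group commutativeRing) public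
    using () renaming (∙-cancelˡ to +-cancelˡ; ∙-cancelʳ to +-cancelʳ)
  open import Algebra.Solver.Ring.NaturalCoefficients.Default
    (CommutativeRing.commutativeSemiring commutativeRing) public
    using (solve; _:=_; _:+_; _:*_; con)
  open import Algebra.Properties.Monoid.Mult (CommutativeRing.+-monoid commutativeRing)
    using () renaming (_×_ to _·_)
  open ≡-Reasoning

  infix 4 _≟_
  _≟_ : DecidableEquality F
  _≟_ = Fin.inj⇒≟ (↔⇒↣ enumeration)

  -- Division is made total by the default value 0 at 0, so that quotients are plain terms; the laws
  -- below assume a nonzero divisor.
  inv : F → F
  inv x with x ≟ 0#
  ... | yes _   = 0#
  ... | no x≢0 = proj₁ (inverse x x≢0)

  *-inv : ∀ {x} → x ≢ 0# → x * inv x ≡ 1#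
  *-inv {x} x≢0 with x ≟ 0#
  ... | yes x≡0 = contradiction x≡0 x≢0
  ... | no x≢0′ = proj₂ (inverse x x≢0′)

  x*[y/x]≡y : ∀ {x} y → x ≢ 0# → x * (y * inv x) ≡ y
  x*[y/x]≡y {x} y x≢0 = begin
    x * (y * inv x) ≡⟨ solve 3 (λ x y i → x :* (y :* i) := x :* i :* y) refl x y (inv x) ⟩
    x * inv x * y   ≡⟨ cong (_* y) (*-inv x≢0) ⟩
    1# * y          ≡⟨ *-identityˡ y ⟩
    y               ∎

  [y/x]*x≡y : ∀ {x} y → x ≢ 0# → y * inv x * x ≡ y
  [y/x]*x≡y y x≢0 = trans (*-comm _ _) (x*[y/x]≡y y x≢0)

  *-cancelˡ : ∀ {x y z} → x ≢ 0# → x * y ≡ x * z → y ≡ z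
  *-cancelˡ {x} {y} {z} x≢0 xy≡xz = begin
    y               ≡⟨ recover y ⟨
    inv x * (x * y) ≡⟨ cong (inv x *_) xy≡xz ⟩
    inv x * (x * z) ≡⟨ recover z ⟩
    z               ∎
    where
    recover : ∀ y → inv x * (x * y) ≡ y
    recover y = trans (solve 3 (λ x y i → i :* (x :* y) := x :* (y :* i)) refl x y (inv x))
                      (x*[y/x]≡y y x≢0)

  *-cancelʳ : ∀ {x y z} → x ≢ 0# → y * x ≡ z * x → y ≡ z
  *-cancelʳ x≢0 yx≡zx = *-cancelˡ x≢0 (trans (*-comm _ _) (trans yx≡zx (*-comm _ _)))

  *-nonzero : ∀ {x y} → x ≢ 0# → y ≢ 0# → x * y ≢ 0#
  *-nonzero x≢0 y≢0 xy≡0 = y≢0 (*-cancelˡ x≢0 (trans xy≡0 (sym (zeroʳ _))))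

  *-nonzeroˡ : ∀ {x y} → x * y ≢ 0# → x ≢ 0#
  *-nonzeroˡ xy≢0 x≡0 = xy≢0 (trans (cong (_* _) x≡0) (zeroˡ _))

  *-nonzeroʳ : ∀ {x y} → x * y ≢ 0# → y ≢ 0#
  *-nonzeroʳ xy≢0 y≡0 = xy≢0 (trans (cong (_ *_) y≡0) (zeroʳ _))

  inv-nonzero : ∀ {x} → x ≢ 0# → inv x ≢ 0#
  inv-nonzero x≢0 = *-nonzeroʳ (λ eq → 1≢0 (trans (sym (*-inv x≢0)) eq))

  -- Polynomial identities are solved here over a commutative semiring, so a difference enters as a
  -- summand d with x = y + d.
  subtract : ∀ x y → ∃ λ d → x ≡ y + d
  subtract x y = - y + x , (begin
    x             ≡⟨ +-identityˡ x ⟨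
    0# + x        ≡⟨ cong (_+ x) (-‿inverseʳ y) ⟨
    y + - y + x   ≡⟨ +-assoc y (- y) x ⟩
    y + (- y + x) ∎)

  -- The solver treats `co p` as a further unknown; its tie to p is `x+co`, applied as a separate
  -- step.
  co : F → F
  co x = 1# + - x

  x+co : ∀ x → x + co x ≡ 1#
  x+co x = begin
    x + (1# + - x) ≡⟨ solve 2 (λ x n → x :+ (con 1 :+ n) := con 1 :+ (x :+ n)) refl x (- x) ⟩
    1# + (x + - x) ≡⟨ cong (1# +_) (-‿inverseʳ x) ⟩
    1# + 0#        ≡⟨ +-identityʳ 1# ⟩
    1#             ∎

  co-unique : ∀ {x y} → x + y ≡ 1# → y ≡ co x
  co-unique {x} x+y≡1 = +-cancelˡ x _ _ (trans x+y≡1 (sym (x+co x)))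

  co-involutive : ∀ x → co (co x) ≡ x
  co-involutive x = sym (co-unique (trans (+-comm _ _) (x+co x)))

  co-nonzero : ∀ {x} → x ≢ 1# → co x ≢ 0#
  co-nonzero {x} x≢1 eq = x≢1 (begin
    x        ≡⟨ +-identityʳ x ⟨
    x + 0#   ≡⟨ cong (x +_) eq ⟨
    x + co x ≡⟨ x+co x ⟩
    1#       ∎)

  co-nonone : ∀ {x} → x ≢ 0# → co x ≢ 1#
  co-nonone {x} x≢0 eq = x≢0 (+-cancelʳ 1# _ _ (begin
    x + 1#   ≡⟨ cong (x +_) eq ⟨
    x + co x ≡⟨ x+co x ⟩
    1#       ≡⟨ +-identityˡ 1# ⟨
    0# + 1#  ∎))

  -- Translation by 1 permutes F, so the sum of all elements is unchanged by
  -- adding q · 1.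
  q·1≡0 : q · 1# ≡ 0#
  q·1≡0 = +-cancelˡ (sum from) _ _ (begin
    sum from + q · 1#               ≡⟨ cong (sum from +_) (sum-replicate q) ⟨
    sum from + sum {q} (const 1#)   ≡⟨ ∑-distrib-+ from (const 1#) ⟨
    sum (λ i → from i + 1#)         ≡⟨ sum-cong-≗ (λ i → strictlyInverseʳ (from i + 1#)) ⟨
    sum (λ i → from (to (from i + 1#))) ≡⟨ sum-permute from permutation ⟨
    sum from                        ≡⟨ +-identityʳ _ ⟨
    sum from + 0#                   ∎)
    where
    open Inverse enumeration
    open import Algebra.Properties.CommutativeMonoid.Sum
      (CommutativeRing.+-commutativeMonoid commutativeRing)
    shift-back : ∀ x m n → m + n ≡ 0# → x + m + n ≡ x
    shift-back x m n eq = trans (+-assoc x m n) (trans (cong (x +_) eq) (+-identityʳ x))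
    translation : F ↔ F
    translation = mk↔ₛ′ (_+ 1#) (_+ - 1#)
      (λ x → shift-back x (- 1#) 1# (-‿inverseˡ 1#))
      (λ x → shift-back x 1# (- 1#) (-‿inverseʳ 1#))
    permutation : Fin q ↔ Fin q
    permutation = enumeration ↔-∘ (translation ↔-∘ ↔-sym enumeration)

  -- If 1 + 1 = 0, every even multiple of 1 vanishes, so for odd q the multiple q · 1 equals 1,
  -- against `q·1≡0`.
  2≢0 : ¬ (2 ∣ q) → 1# + 1# ≢ 0#
  2≢0 2∤q 1+1≡0 with q % 2 in q%2≡r | m%n<n q 2
  ... | 0 | _ = 2∤q (m%n≡0⇒n∣m q 2 q%2≡r)
  ... | 1 | _ = 1≢0 (begin
    1#                       ≡⟨ +-identityʳ 1# ⟨
    1# + 0#                  ≡⟨ cong (1# +_) (multiple (q / 2)) ⟨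
    suc (q / 2 ℕ.* 2) · 1#   ≡⟨ cong (_· 1#) (trans (m≡m%n+[m/n]*n q 2) (cong (ℕ._+ q / 2 ℕ.* 2) q%2≡r)) ⟨
    q · 1#                   ≡⟨ q·1≡0 ⟩
    0#                       ∎)
    where
    multiple : ∀ k → (k ℕ.* 2) · 1# ≡ 0#
    multiple ℕ.zero  = refl
    multiple (suc k) = begin
      1# + (1# + (k ℕ.* 2) · 1#) ≡⟨ +-assoc _ _ _ ⟨
      1# + 1# + (k ℕ.* 2) · 1#   ≡⟨ cong₂ _+_ 1+1≡0 (multiple k) ⟩
      0# + 0#                    ≡⟨ +-identityʳ 0# ⟩
      0#                         ∎
  ... | suc (suc _) | ℕ.s≤s (ℕ.s≤s ())

  -- Counting admissible parameters.

  NonZeroOne : Pred F _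
  NonZeroOne = (U ∩ ∁ (_≡ 0#)) ∩ ∁ (_≡ 1#)

  card-nonzero : Card (U ∩ ∁ (_≡ 0#)) (q ∸ 1)
  card-nonzero = card-exclude {n = q} {k = 0} (card-full enumeration) (0# , tt , refl , id)

  card-nonzeroone : Card NonZeroOne (q ∸ 2)
  card-nonzeroone = card-exclude {n = q} {k = 1} card-nonzero (1# , (tt , 1≢0) , refl , id)

  abstract
    -- Removing three elements from F leaves some over. This supplies a second point on a given
    -- conic, and a scalar other than 0, 1 and -1.
    nonzeroone-avoiding : 5 ℕ.≤ q → ∀ {x} → x ≢ 0# → x ≢ 1# → ∃ (NonZeroOne ∩ ∁ (_≡ x))
    nonzeroone-avoiding 5≤q x≢0 x≢1 = card-nonempty
      -- `suc q ∸ 4` computes to `q ∸ 3`, so 4 ≤ q exhibits the size as `suc (q ∸ 4)`.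
      (subst (Card _) (ℕ.+-∸-assoc 1 (ℕ.≤-trans (ℕ.n≤1+n 4) 5≤q))
        (card-exclude {n = q} {k = 2} card-nonzeroone (_ , ((tt , x≢0) , x≢1) , refl , id)))

  -- A parameter p in this set is one for which the point of the conic
  -- (w y) x' + (z x) y' = x' y' with parameter p shares a conic with (1, x, y).
  Visible : F → F → Pred F _
  Visible w z = ((NonZeroOne ∩ ∁ (_≡ w)) ∩ ∁ (λ p → co p ≡ z)) ∩ ∁ (λ p → w * co p ≡ z * p)

  -- The three exclusions remove p = w, p = 1 - z and p = w / (w + z), which are
  -- distinct because w + z ≠ 1.
  card-visible : ∀ {w z} → w ≢ 0# → z ≢ 0# → w + z ≢ 1# →
                 (w≢1? : Dec (w ≢ 1#)) (z≢1? : Dec (z ≢ 1#)) (w+z≢0? : Dec (w + z ≢ 0#)) →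
                 Card (Visible w z) (q ∸ decrement w+z≢0? (decrement z≢1? (decrement w≢1? 2)))
  card-visible {w} {z} w≢0 z≢0 w+z≢1 w≢1? z≢1? w+z≢0? =
    card-exclude? {n = q} {k = decrement z≢1? (decrement w≢1? 2)} w+z≢0?
      (card-exclude? {n = q} {k = decrement w≢1? 2} z≢1?
        (card-exclude? {n = q} {k = 2} w≢1? card-nonzeroone hit₁ miss₁)
        hit₂ miss₂)
      hit₃ miss₃
    where
    hit₁ : w ≢ 1# → ∃ λ p → NonZeroOne p × p ≡ w × (∀ {r} → r ≡ w → r ≡ p)
    hit₁ w≢1 = w , ((tt , w≢0) , w≢1) , refl , id

    miss₁ : ¬ (w ≢ 1#) → ∀ {p} → NonZeroOne p → p ≢ w
    -- For w = 1 the exclusion of w repeats that of 1.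
    miss₁ ¬w≢1 (_ , p≢1) p≡w = p≢1 (trans p≡w (decidable-stable (w ≟ 1#) ¬w≢1))

    hit₂ : z ≢ 1# → ∃ λ p → (NonZeroOne ∩ ∁ (_≡ w)) p × co p ≡ z × (∀ {r} → co r ≡ z → r ≡ p)
    hit₂ z≢1 = co z
      , (((tt , co-nonzero z≢1) , co-nonone z≢0)
        , λ co≡w → w+z≢1 (trans (+-comm w z) (trans (cong (z +_) (sym co≡w)) (x+co z))))
      , co-involutive z
      , λ {r} co≡z → trans (sym (co-involutive r)) (cong co co≡z)

    miss₂ : ¬ (z ≢ 1#) → ∀ {p} → (NonZeroOne ∩ ∁ (_≡ w)) p → co p ≢ z
    miss₂ ¬z≢1 (((_ , p≢0) , _) , _) co≡z =
      co-nonone p≢0 (trans co≡z (decidable-stable (z ≟ 1#) ¬z≢1))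

    split : ∀ x p → x * p + x * co p ≡ x
    split x p = trans (sym (distribˡ x p (co p))) (trans (cong (x *_) (x+co p)) (*-identityʳ x))

    -- Adding w p to both sides gives an equation with p as a factor: its root is w / (w + z) when w
    -- + z ≠ 0, and it forces w = 0 otherwise.
    proportional : ∀ {p} → w * co p ≡ z * p → p * (w + z) ≡ w
    proportional {p} eq = begin
      p * (w + z)       ≡⟨ solve 3 (λ p w z → p :* (w :+ z) := w :* p :+ z :* p) refl p w z ⟩
      w * p + z * p     ≡⟨ cong (w * p +_) eq ⟨
      w * p + w * co p  ≡⟨ split w p ⟩
      w                 ∎

    hit₃ : w + z ≢ 0# → ∃ λ p → ((NonZeroOne ∩ ∁ (_≡ w)) ∩ ∁ (λ p → co p ≡ z)) p ×
                                w * co p ≡ z * p × (∀ {r} → w * co r ≡ z * r → r ≡ p)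
    hit₃ w+z≢0 = p , ((((tt , p≢0) , p≢1) , p≢w) , co≢z) , balanced
               , λ eq → *-cancelʳ w+z≢0 (trans (proportional eq) (sym p*[w+z]≡w))
      where
      p : F
      p = w * inv (w + z)
      p*[w+z]≡w : p * (w + z) ≡ w
      p*[w+z]≡w = [y/x]*x≡y w w+z≢0
      balanced : w * co p ≡ z * p
      balanced = +-cancelˡ (w * p) _ _ (begin
        w * p + w * co p ≡⟨ split w p ⟩
        w                ≡⟨ p*[w+z]≡w ⟨
        p * (w + z)      ≡⟨ solve 3 (λ p w z → p :* (w :+ z) := w :* p :+ z :* p) refl p w z ⟩
        w * p + z * p    ∎)
      p≢0 : p ≢ 0#
      p≢0 = *-nonzero w≢0 (inv-nonzero w+z≢0)
      p≢1 : p ≢ 1#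
      p≢1 p≡1 = z≢0 (+-cancelˡ w _ _ (begin
        w + z        ≡⟨ *-identityˡ _ ⟨
        1# * (w + z) ≡⟨ cong (_* (w + z)) p≡1 ⟨
        p * (w + z)  ≡⟨ p*[w+z]≡w ⟩
        w            ≡⟨ +-identityʳ w ⟨
        w + 0#       ∎))
      p≢w : p ≢ w
      p≢w p≡w = w+z≢1 (*-cancelˡ w≢0 (begin
        w * (w + z) ≡⟨ cong (_* (w + z)) p≡w ⟨
        p * (w + z) ≡⟨ p*[w+z]≡w ⟩
        w           ≡⟨ *-identityʳ w ⟨
        w * 1#      ∎))
      co≢z : co p ≢ z
      -- With 1 - p = z the balance reads w z = z p, hence p = w and w + z = 1. The chain carries
      -- this out multiplied by z.
      co≢z co≡z = w+z≢1 (*-cancelˡ z≢0 (begin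
        z * (w + z)       ≡⟨ distribˡ z w z ⟩
        z * w + z * z     ≡⟨ cong (λ c → z * w + z * c) co≡z ⟨
        z * w + z * co p  ≡⟨ cong (_+ z * co p) (*-comm z w) ⟩
        w * z + z * co p  ≡⟨ cong (λ c → w * c + z * co p) co≡z ⟨
        w * co p + z * co p ≡⟨ cong (_+ z * co p) balanced ⟩
        z * p + z * co p  ≡⟨ split z p ⟩
        z                 ≡⟨ *-identityʳ z ⟨
        z * 1#            ∎))

    miss₃ : ¬ (w + z ≢ 0#) → ∀ {p} → ((NonZeroOne ∩ ∁ (_≡ w)) ∩ ∁ (λ p → co p ≡ z)) p →
            w * co p ≢ z * p
    miss₃ ¬w+z≢0 {p} _ eq = w≢0 (begin
      w           ≡⟨ proportional eq ⟨
      p * (w + z) ≡⟨ cong (p *_) (decidable-stable (w + z ≟ 0#) ¬w+z≢0) ⟩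
      p * 0#      ≡⟨ zeroʳ p ⟩
      0#          ∎)

-- Points in general position with the frame.

abstract
  -- Settled by exhausting all triples of indices. It turns three distinct members of a list of four
  -- points into the position of the one left out, so that collinearity has only four cases.
  omits-at-most-one : ∀ (i j k : Fin 4) → i ≢ j → j ≢ k → i ≢ k →
                      ∃ λ l → ∀ m → m ≢ l → m ≡ i ⊎ m ≡ j ⊎ m ≡ k
  omits-at-most-one = from-yes (Fin.all? {n = 4} λ i → Fin.all? λ j → Fin.all? λ k →
    ¬? (i Fin.≟ j) →-dec (¬? (j Fin.≟ k) →-dec (¬? (i Fin.≟ k) →-dec
      Fin.any? λ l → Fin.all? λ m →
        ¬? (m Fin.≟ l) →-dec ((m Fin.≟ i) ⊎-dec ((m Fin.≟ j) ⊎-dec (m Fin.≟ k))))))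

module PlaneProperties {q : ℕ} (𝔽 : FiniteField q) where
  open FiniteField 𝔽
  open Plane 𝔽
  open FieldProperties 𝔽
  open import Algebra.Properties.Semiring.Sum
    (CommutativeRing.semiring commutativeRing) using (sum)
  open import Algebra.Properties.Ring (CommutativeRing.ring commutativeRing) using (-1*x≈-x)
  open import Algebra.Properties.Group (CommutativeRing.+-group commutativeRing)
    using (⁻¹-involutive)
  open ≡-Reasoning

  onLine-e₁ : ∀ {u} → OnLine u e₁ → u 0F ≡ 0#
  onLine-e₁ {u} = trans (solve 3 (λ a b c →
    a := a :* con 1 :+ (b :* con 0 :+ (c :* con 0 :+ con 0))) refl (u 0F) (u 1F) (u 2F))

  onLine-e₂ : ∀ {u} → OnLine u e₂ → u 1F ≡ 0#
  onLine-e₂ {u} = trans (solve 3 (λ a b c →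
    b := a :* con 0 :+ (b :* con 1 :+ (c :* con 0 :+ con 0))) refl (u 0F) (u 1F) (u 2F))

  onLine-e₃ : ∀ {u} → OnLine u e₃ → u 2F ≡ 0#
  onLine-e₃ {u} = trans (solve 3 (λ a b c →
    c := a :* con 0 :+ (b :* con 0 :+ (c :* con 1 :+ con 0))) refl (u 0F) (u 1F) (u 2F))

  onLine-affine : ∀ {u x y} → OnLine u [1∶ x ∶ y ] → u 0F + u 1F * x + u 2F * y ≡ 0#
  onLine-affine {u} {x} {y} = trans (solve 5 (λ a b c x y →
    a :+ b :* x :+ c :* y := a :* con 1 :+ (b :* x :+ (c :* y :+ con 0)))
    refl (u 0F) (u 1F) (u 2F) x y)

  -- The normalised points without a zero coordinate. `torus-in-𝒫₁` and `𝒫₁⇒torus` identify this set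
  -- with `𝒫₁`.
  data Torus : Pred Point 0ℓ where
    torus : ∀ {x y} → x ≢ 0# → y ≢ 0# → Torus [1∶ x ∶ y ]

  module _ {x y : F} (x≢0 : x ≢ 0#) (y≢0 : y ≢ 0#) where

    private
      quadrangle : List Point
      quadrangle = [1∶ x ∶ y ] ∷ e₁ ∷ e₂ ∷ e₃ ∷ []

    -- A vertex on the line kills its coordinate of u. If a vertex is the omitted point, the other
    -- two coordinates vanish and incidence with (1, x, y) leaves the third times a nonzero factor.
    line-through-three : ∀ {u} (l : Fin 4) → (∀ m → m ≢ l → OnLine u (lookup quadrangle m)) →
                         ∀ i → u i ≡ 0#
    line-through-three {u} l on = λ where
        0F → vanish₀ l on
        1F → vanish₁ l on
        2F → vanish₂ l on
      where
      -- In each case, a coordinate whose own vertex is missed is recovered from (1, x, y).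
      OnAllBut : Fin 4 → Set
      OnAllBut l = ∀ m → m ≢ l → OnLine u (lookup quadrangle m)

      vanish₀ : ∀ l → OnAllBut l → u 0F ≡ 0#
      -- In `quadrangle` position 0 is (1, x, y) and e₁ has position 1, while its coordinate in u
      -- has index 0; hence the shift by one between `1F` and `u 0F`.
      vanish₀ 1F on = begin
        u 0F                         ≡⟨ solve 3 (λ a x y → a := a :+ con 0 :* x :+ con 0 :* y) refl (u 0F) x y ⟩
        u 0F + 0# * x + 0# * y       ≡⟨ cong₂ (λ b c → u 0F + b * x + c * y) (onLine-e₂ {u} (on 2F λ ())) (onLine-e₃ {u} (on 3F λ ())) ⟨
        u 0F + u 1F * x + u 2F * y   ≡⟨ onLine-affine {u} (on 0F λ ()) ⟩
        0#                           ∎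
      vanish₀ 0F on = onLine-e₁ {u} (on 1F λ ())
      vanish₀ 2F on = onLine-e₁ {u} (on 1F λ ())
      vanish₀ 3F on = onLine-e₁ {u} (on 1F λ ())

      vanish₁ : ∀ l → OnAllBut l → u 1F ≡ 0#
      vanish₁ 2F on = *-cancelʳ x≢0 (begin
        u 1F * x                     ≡⟨ solve 3 (λ b x y → b :* x := con 0 :+ b :* x :+ con 0 :* y) refl (u 1F) x y ⟩
        0# + u 1F * x + 0# * y       ≡⟨ cong₂ (λ a c → a + u 1F * x + c * y) (onLine-e₁ {u} (on 1F λ ())) (onLine-e₃ {u} (on 3F λ ())) ⟨
        u 0F + u 1F * x + u 2F * y   ≡⟨ onLine-affine {u} (on 0F λ ()) ⟩
        0#                           ≡⟨ zeroˡ x ⟨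
        0# * x                       ∎)
      vanish₁ 0F on = onLine-e₂ {u} (on 2F λ ())
      vanish₁ 1F on = onLine-e₂ {u} (on 2F λ ())
      vanish₁ 3F on = onLine-e₂ {u} (on 2F λ ())

      vanish₂ : ∀ l → OnAllBut l → u 2F ≡ 0#
      vanish₂ 3F on = *-cancelʳ y≢0 (begin
        u 2F * y                     ≡⟨ solve 3 (λ c x y → c :* y := con 0 :+ con 0 :* x :+ c :* y) refl (u 2F) x y ⟩
        0# + 0# * x + u 2F * y       ≡⟨ cong₂ (λ a b → a + b * x + u 2F * y) (onLine-e₁ {u} (on 1F λ ())) (onLine-e₂ {u} (on 2F λ ())) ⟨
        u 0F + u 1F * x + u 2F * y   ≡⟨ onLine-affine {u} (on 0F λ ()) ⟩
        0#                           ≡⟨ zeroˡ y ⟨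
        0# * y                       ∎)
      vanish₂ 0F on = onLine-e₃ {u} (on 3F λ ())
      vanish₂ 1F on = onLine-e₃ {u} (on 3F λ ())
      vanish₂ 2F on = onLine-e₃ {u} (on 3F λ ())

    torus-in-𝒫₁ : [1∶ x ∶ y ] ∈ 𝒫₁
    torus-in-𝒫₁ = off-frame , general
      where
      off-frame : ¬ [1∶ x ∶ y ] ∈ₗ e₁ ∷ e₂ ∷ e₃ ∷ []
      off-frame (here refl) = x≢0 refl
      off-frame (there (there (there ())))

      general : ∀ {X Y Z} → X ∈ₗ quadrangle → Y ∈ₗ quadrangle → Z ∈ₗ quadrangle →
                X ≢ Y → Y ≢ Z → X ≢ Z → ¬ Collinear X Y Z
      general X∈ Y∈ Z∈ X≢Y Y≢Z X≢Z (u , (i , uᵢ≢0) , onX , onY , onZ) =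
        uᵢ≢0 (line-through-three {u} l onAllBut i)
        where
        X≡ = Any.lookup-index X∈
        Y≡ = Any.lookup-index Y∈
        Z≡ = Any.lookup-index Z∈
        distinct : ∀ {V W : Point} {m n : Fin 4} → V ≡ lookup quadrangle m → W ≡ lookup quadrangle n →
                   V ≢ W → m ≢ n
        distinct V≡ W≡ V≢W refl = V≢W (trans V≡ (sym W≡))
        covering = omits-at-most-one (Any.index X∈) (Any.index Y∈) (Any.index Z∈)
          (distinct X≡ Y≡ X≢Y) (distinct Y≡ Z≡ Y≢Z) (distinct X≡ Z≡ X≢Z)
        l = proj₁ covering
        onAllBut : ∀ m → m ≢ l → OnLine u (lookup quadrangle m)
        onAllBut m m≢l with proj₂ covering m m≢l
        ... | inj₁ refl        = subst (OnLine u) X≡ onX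
        ... | inj₂ (inj₁ refl) = subst (OnLine u) Y≡ onY
        ... | inj₂ (inj₂ refl) = subst (OnLine u) Z≡ onZ

  -- A zero coordinate puts P on a side of the triangle of reference: x = 0 on e₁e₃, y = 0 on e₁e₂,
  -- and a vanishing first coordinate on e₂e₃. The coordinate vector of that side witnesses the
  -- forbidden collinearity.
  𝒫₁⇒torus : ∀ {P} → P ∈ 𝒫₁ → Torus P
  𝒫₁⇒torus {[1∶ x ∶ y ]} (off-frame , general) = torus
    (λ { refl → general (here refl) (there (here refl)) (there (there (there (here refl))))
           (off-frame ∘ here) (λ ()) (λ ())
           (0# Vector.∷ 1# Vector.∷ 0# Vector.∷ Vector.[] , (1F , 1≢0)
           , solve 1 (λ y → con 0 :* con 1 :+ (con 1 :* con 0 :+ (con 0 :* y :+ con 0)) := con 0) refl y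
           , solve 0 (con 0 :* con 1 :+ (con 1 :* con 0 :+ (con 0 :* con 0 :+ con 0)) := con 0) refl
           , solve 0 (con 0 :* con 0 :+ (con 1 :* con 0 :+ (con 0 :* con 1 :+ con 0)) := con 0) refl) })
    (λ { refl → general (here refl) (there (here refl)) (there (there (here refl)))
           (off-frame ∘ here) (λ ()) (λ ())
           (0# Vector.∷ 0# Vector.∷ 1# Vector.∷ Vector.[] , (2F , 1≢0)
           , solve 1 (λ x → con 0 :* con 1 :+ (con 0 :* x :+ (con 1 :* con 0 :+ con 0)) := con 0) refl x
           , solve 0 (con 0 :* con 1 :+ (con 0 :* con 0 :+ (con 1 :* con 0 :+ con 0)) := con 0) refl
           , solve 0 (con 0 :* con 0 :+ (con 0 :* con 1 :+ (con 1 :* con 0 :+ con 0)) := con 0) refl) })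
  𝒫₁⇒torus {[0∶1∶ z ]} (off-frame , general) = contradiction
    (1# Vector.∷ 0# Vector.∷ 0# Vector.∷ Vector.[] , (0F , 1≢0)
    , solve 1 (λ z → con 1 :* con 0 :+ (con 0 :* con 1 :+ (con 0 :* z :+ con 0)) := con 0) refl z
    , solve 0 (con 1 :* con 0 :+ (con 0 :* con 1 :+ (con 0 :* con 0 :+ con 0)) := con 0) refl
    , solve 0 (con 1 :* con 0 :+ (con 0 :* con 0 :+ (con 0 :* con 1 :+ con 0)) := con 0) refl)
    (general (here refl) (there (there (here refl))) (there (there (there (here refl))))
      (λ P≡e₂ → off-frame (there (here P≡e₂))) (λ ()) (λ ()))
  𝒫₁⇒torus {[0∶0∶1]} (off-frame , _) = contradiction (there (there (here refl))) off-frame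

  -- Conics through the vertices of the frame.

  -- The toric part of the conic whose matrix has the entries a, b, -1 above its zero diagonal.
  data Conic (a b : F) : Pred Point 0ℓ where
    on : ∀ {x y} → x ≢ 0# → y ≢ 0# → a * x + b * y ≡ x * y → Conic a b [1∶ x ∶ y ]

  private
    -- -1 as an unknown for the semiring solver, with its sign behaviour restored by `n*n≡1`.
    n : F
    n = - 1#

    -- The ternary quadratic form of the symmetric matrix with diagonal a, b, c and entries α, β, γ
    -- above it.
    form : (a b c α β γ x y z : F) → F
    form a b c α β γ x y z =
      a * (x * x) + b * (y * y) + c * (z * z) + (1# + 1#) * (α * (x * y) + β * (x * z) + γ * (y * z))

    n*n≡1 : n * n ≡ 1#
    n*n≡1 = trans (-1*x≈-x n) (⁻¹-involutive 1#)

    n≢0 : n ≢ 0#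
    n≢0 n≡0 = 1≢0 (trans (sym n*n≡1) (trans (cong (n *_) n≡0) (zeroʳ n)))

    form-e₁ : ∀ a b c α β γ → a ≡ form a b c α β γ 1# 0# 0#
    form-e₁ = solve 6 (λ a b c α β γ →
      a := a :* (con 1 :* con 1) :+ b :* (con 0 :* con 0) :+ c :* (con 0 :* con 0)
           :+ (con 1 :+ con 1) :* (α :* (con 1 :* con 0) :+ β :* (con 1 :* con 0) :+ γ :* (con 0 :* con 0))) refl

    form-e₂ : ∀ a b c α β γ → b ≡ form a b c α β γ 0# 1# 0#
    form-e₂ = solve 6 (λ a b c α β γ →
      b := a :* (con 0 :* con 0) :+ b :* (con 1 :* con 1) :+ c :* (con 0 :* con 0)
           :+ (con 1 :+ con 1) :* (α :* (con 0 :* con 1) :+ β :* (con 0 :* con 0) :+ γ :* (con 1 :* con 0))) refl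

    form-e₃ : ∀ a b c α β γ → c ≡ form a b c α β γ 0# 0# 1#
    form-e₃ = solve 6 (λ a b c α β γ →
      c := a :* (con 0 :* con 0) :+ b :* (con 0 :* con 0) :+ c :* (con 1 :* con 1)
           :+ (con 1 :+ con 1) :* (α :* (con 0 :* con 0) :+ β :* (con 0 :* con 1) :+ γ :* (con 0 :* con 1))) refl

  module _ (A : Matrix₃) (symmetric : IsSymmetric A) where

    private
      α β γ : F
      α = A 0F 1F
      β = A 0F 2F
      γ = A 1F 2F

    zeros-form : ∀ X → let v = coords X in
      sum (λ i → sum (λ j → coords X i * A i j * coords X j)) ≡
      form (A 0F 0F) (A 1F 1F) (A 2F 2F) α β γ (v 0F) (v 1F) (v 2F)
    zeros-form X
      rewrite symmetric 1F 0F | symmetric 2F 0F | symmetric 2F 1F =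
      solve 9 (λ a b c α β γ x y z →
        (x :* a :* x :+ (x :* α :* y :+ (x :* β :* z :+ con 0))) :+
        ((y :* α :* x :+ (y :* b :* y :+ (y :* γ :* z :+ con 0))) :+
        ((z :* β :* x :+ (z :* γ :* y :+ (z :* c :* z :+ con 0))) :+ con 0))
        := a :* (x :* x) :+ b :* (y :* y) :+ c :* (z :* z)
           :+ (con 1 :+ con 1) :* (α :* (x :* y) :+ β :* (x :* z) :+ γ :* (y :* z)))
        refl (A 0F 0F) (A 1F 1F) (A 2F 2F) α β γ (coords X 0F) (coords X 1F) (coords X 2F)

    zeros-e₁ : Zeros A e₁ → A 0F 0F ≡ 0#
    zeros-e₁ zero = trans (form-e₁ _ _ _ α β γ) (trans (sym (zeros-form e₁)) zero)

    zeros-e₂ : Zeros A e₂ → A 1F 1F ≡ 0#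
    zeros-e₂ zero = trans (form-e₂ _ _ _ α β γ) (trans (sym (zeros-form e₂)) zero)

    zeros-e₃ : Zeros A e₃ → A 2F 2F ≡ 0#
    zeros-e₃ zero = trans (form-e₃ _ _ _ α β γ) (trans (sym (zeros-form e₃)) zero)

    module _ (A₀₀≡0 : A 0F 0F ≡ 0#) (A₁₁≡0 : A 1F 1F ≡ 0#) (A₂₂≡0 : A 2F 2F ≡ 0#) where

      -- Of the six permutations only the two 3-cycles avoid the diagonal, and by symmetry each
      -- contributes α β γ. As 2 ≠ 0, nondegeneracy will mean that α, β and γ are all nonzero.
      det-zero-diagonal : det A ≡ (1# + 1#) * (α * β * γ)
      det-zero-diagonal
        rewrite A₀₀≡0 | A₁₁≡0 | A₂₂≡0 | symmetric 1F 0F | symmetric 2F 0F | symmetric 2F 1F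
              | sym (-1*x≈-x (γ * γ)) | sym (-1*x≈-x (γ * β)) | sym (-1*x≈-x (0# * β))
              | sym (-1*x≈-x (α * (α * 0# + n * (γ * β)))) = begin
        -- The rewrites have replaced negations by multiplication by `n`, inner ones first, which is
        -- why the last pattern already contains `n`.
        _ ≡⟨ solve 4 (λ α β γ n →
               con 0 :* (con 0 :* con 0 :+ n :* (γ :* γ)) :+ n :* (α :* (α :* con 0 :+ n :* (γ :* β)))
               :+ β :* (α :* γ :+ n :* (con 0 :* β))
               := n :* n :* (α :* β :* γ) :+ α :* β :* γ) refl α β γ n ⟩
        n * n * (α * β * γ) + α * β * γ ≡⟨ cong (λ m → m * (α * β * γ) + α * β * γ) n*n≡1 ⟩
        1# * (α * β * γ) + α * β * γ    ≡⟨ solve 1 (λ d → con 1 :* d :+ d := (con 1 :+ con 1) :* d) refl (α * β * γ) ⟩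
        (1# + 1#) * (α * β * γ)         ∎

      zeros-torus : ∀ x y → sum (λ i → sum (λ j → coords [1∶ x ∶ y ] i * A i j * coords [1∶ x ∶ y ] j)) ≡
                    (1# + 1#) * (α * x + β * y + γ * (x * y))
      zeros-torus x y = begin
        _ ≡⟨ zeros-form [1∶ x ∶ y ] ⟩
        form (A 0F 0F) (A 1F 1F) (A 2F 2F) α β γ 1# x y
          ≡⟨ cong (λ a → form a (A 1F 1F) (A 2F 2F) α β γ 1# x y) A₀₀≡0 ⟩
        form 0# (A 1F 1F) (A 2F 2F) α β γ 1# x y
          ≡⟨ cong₂ (λ b c → form 0# b c α β γ 1# x y) A₁₁≡0 A₂₂≡0 ⟩
        form 0# 0# 0# α β γ 1# x y
          ≡⟨ solve 5 (λ α β γ x y →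
               con 0 :* (con 1 :* con 1) :+ con 0 :* (x :* x) :+ con 0 :* (y :* y)
               :+ (con 1 :+ con 1) :* (α :* (con 1 :* x) :+ β :* (con 1 :* y) :+ γ :* (x :* y))
               := (con 1 :+ con 1) :* (α :* x :+ β :* y :+ γ :* (x :* y))) refl α β γ x y ⟩
        (1# + 1#) * (α * x + β * y + γ * (x * y)) ∎

  module _ (2≢0 : 1# + 1# ≢ 0#) where

    -- The three vertices force a zero diagonal, and the determinant then makes α, β, γ nonzero.
    -- Scaling by g = -1/γ brings the last entry to -1.
    block⇒conic : ∀ {B} → B ∈ ℬ₁ → ∃₂ λ a b → a ≢ 0# × b ≢ 0# × B ≐ Conic a b
    block⇒conic {B} (O , ((A , symmetric , det≢0 , O⊆ , O⊇) , e₁∈ , e₂∈ , e₃∈) , B⊆ , B⊇) =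
      α * g , β * g , *-nonzero α≢0 g≢0 , *-nonzero β≢0 g≢0
      , (λ P∈B → let P∈O , P∈𝒫 = B⊆ P∈B in into (O⊆ P∈O) (𝒫₁⇒torus P∈𝒫))
      , λ { (on x≢0 y≢0 eq) → B⊇ (O⊇ (from-conic eq) , torus-in-𝒫₁ x≢0 y≢0) }
      where
      α β γ g : F
      α = A 0F 1F
      β = A 0F 2F
      γ = A 1F 2F
      A₀₀≡0 = zeros-e₁ A symmetric (O⊆ e₁∈)
      A₁₁≡0 = zeros-e₂ A symmetric (O⊆ e₂∈)
      A₂₂≡0 = zeros-e₃ A symmetric (O⊆ e₃∈)
      αβγ≢0 : α * β * γ ≢ 0#
      αβγ≢0 = *-nonzeroʳ (det≢0 ∘ trans (det-zero-diagonal A symmetric A₀₀≡0 A₁₁≡0 A₂₂≡0))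
      α≢0 = *-nonzeroˡ (*-nonzeroˡ αβγ≢0)
      β≢0 = *-nonzeroʳ (*-nonzeroˡ αβγ≢0)
      γ≢0 = *-nonzeroʳ αβγ≢0
      g = n * inv γ
      g≢0 : g ≢ 0#
      g≢0 = *-nonzero n≢0 (inv-nonzero γ≢0)
      γ*g≡n : γ * g ≡ n
      γ*g≡n = x*[y/x]≡y n γ≢0

      into : ∀ {P} → P ∈ Zeros A → Torus P → Conic (α * g) (β * g) P
      into P∈ (torus {x} {y} x≢0 y≢0) = on x≢0 y≢0 (begin
        α * g * x + β * g * y
          -- A zero multiple of x y is added and rewritten with γ g + 1, which completes g times the
          -- form of the conic.
          ≡⟨ solve 2 (λ s t → s := s :+ con 0 :* t) refl _ (x * y) ⟩
        α * g * x + β * g * y + 0# * (x * y)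
          ≡⟨ cong (λ c → α * g * x + β * g * y + c * (x * y)) γg+1≡0 ⟨
        α * g * x + β * g * y + (γ * g + 1#) * (x * y)
          ≡⟨ solve 6 (λ α β γ g x y → α :* g :* x :+ β :* g :* y :+ (γ :* g :+ con 1) :* (x :* y)
               := (α :* x :+ β :* y :+ γ :* (x :* y)) :* g :+ x :* y) refl α β γ g x y ⟩
        (α * x + β * y + γ * (x * y)) * g + x * y
          ≡⟨ cong (λ s → s * g + x * y) vanishes ⟩
        0# * g + x * y
          ≡⟨ solve 2 (λ g t → con 0 :* g :+ t := t) refl g (x * y) ⟩
        x * y ∎)
        where
        γg+1≡0 : γ * g + 1# ≡ 0#
        γg+1≡0 = trans (cong (_+ 1#) γ*g≡n) (-‿inverseˡ 1#)
        vanishes : α * x + β * y + γ * (x * y) ≡ 0#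
        vanishes = *-cancelˡ 2≢0 (begin
          (1# + 1#) * (α * x + β * y + γ * (x * y)) ≡⟨ zeros-torus A symmetric A₀₀≡0 A₁₁≡0 A₂₂≡0 x y ⟨
          _                                         ≡⟨ P∈ ⟩
          0#                                        ≡⟨ zeroʳ _ ⟨
          (1# + 1#) * 0#                            ∎)

      from-conic : ∀ {x y} → α * g * x + β * g * y ≡ x * y → Zeros A [1∶ x ∶ y ]
      from-conic {x} {y} eq = begin
        _ ≡⟨ zeros-torus A symmetric A₀₀≡0 A₁₁≡0 A₂₂≡0 x y ⟩
        (1# + 1#) * (α * x + β * y + γ * (x * y))
          -- Replacing x y in the γ term alone makes γ g + 1 = 0 a common factor.
          ≡⟨ cong (λ t → (1# + 1#) * (α * x + β * y + γ * t)) eq ⟨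
        (1# + 1#) * (α * x + β * y + γ * (α * g * x + β * g * y))
          ≡⟨ solve 6 (λ α β γ g x y →
               (con 1 :+ con 1) :* (α :* x :+ β :* y :+ γ :* (α :* g :* x :+ β :* g :* y))
               := (γ :* g :+ con 1) :* ((con 1 :+ con 1) :* (α :* x :+ β :* y))) refl α β γ g x y ⟩
        (γ * g + 1#) * ((1# + 1#) * (α * x + β * y))
          ≡⟨ cong (λ c → (c + 1#) * ((1# + 1#) * (α * x + β * y))) γ*g≡n ⟩
        (n + 1#) * ((1# + 1#) * (α * x + β * y))
          ≡⟨ cong (_* ((1# + 1#) * (α * x + β * y))) (-‿inverseˡ 1#) ⟩
        0# * ((1# + 1#) * (α * x + β * y))
          ≡⟨ zeroˡ _ ⟩
        0# ∎

    conic⇒block : ∀ {a b} → a ≢ 0# → b ≢ 0# → Conic a b ∈ ℬ₁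
    conic⇒block {a} {b} a≢0 b≢0 =
      Zeros A , ((A , symmetric , det≢0 , id , id)
                , zero-on e₁ (form-e₁ 0# 0# 0# a b n) , zero-on e₂ (form-e₂ 0# 0# 0# a b n)
                , zero-on e₃ (form-e₃ 0# 0# 0# a b n))
      , (λ { (on x≢0 y≢0 eq) → to-zeros eq , torus-in-𝒫₁ x≢0 y≢0 })
      , λ (P∈ , P∈𝒫) → from-zeros P∈ (𝒫₁⇒torus P∈𝒫)
      where
      A : Matrix₃
      A 0F 1F = a
      A 1F 0F = a
      A 0F 2F = b
      A 2F 0F = b
      A 1F 2F = n
      A 2F 1F = n
      A 0F 0F = 0#
      A 1F 1F = 0#
      A 2F 2F = 0#

      symmetric : IsSymmetric A
      symmetric 0F 0F = refl
      symmetric 0F 1F = refl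
      symmetric 0F 2F = refl
      symmetric 1F 0F = refl
      symmetric 1F 1F = refl
      symmetric 1F 2F = refl
      symmetric 2F 0F = refl
      symmetric 2F 1F = refl
      symmetric 2F 2F = refl

      det≢0 : det A ≢ 0#
      det≢0 eq = *-nonzero 2≢0 (*-nonzero (*-nonzero a≢0 b≢0) n≢0)
        (trans (sym (det-zero-diagonal A symmetric refl refl refl)) eq)

      zero-on : ∀ X → 0# ≡ form 0# 0# 0# a b n (coords X 0F) (coords X 1F) (coords X 2F) → X ∈ Zeros A
      zero-on X eq = trans (zeros-form A symmetric X) (sym eq)

      cancel : ∀ s → s + n * s ≡ 0#
      cancel s = begin
        s + n * s      ≡⟨ solve 2 (λ s n → s :+ n :* s := (n :+ con 1) :* s) refl s n ⟩
        (n + 1#) * s   ≡⟨ cong (_* s) (-‿inverseˡ 1#) ⟩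
        0# * s         ≡⟨ zeroˡ s ⟩
        0#             ∎

      to-zeros : ∀ {x y} → a * x + b * y ≡ x * y → Zeros A [1∶ x ∶ y ]
      to-zeros {x} {y} eq = begin
        _ ≡⟨ zeros-torus A symmetric refl refl refl x y ⟩
        (1# + 1#) * (a * x + b * y + n * (x * y)) ≡⟨ cong (λ s → (1# + 1#) * (s + n * (x * y))) eq ⟩
        (1# + 1#) * (x * y + n * (x * y))         ≡⟨ cong ((1# + 1#) *_) (cancel (x * y)) ⟩
        (1# + 1#) * 0#                            ≡⟨ zeroʳ _ ⟩
        0#                                        ∎

      from-zeros : ∀ {P} → P ∈ Zeros A → Torus P → Conic a b P
      from-zeros P∈ (torus {x} {y} x≢0 y≢0) = on x≢0 y≢0
        (+-cancelʳ (n * (x * y)) _ _ (*-cancelˡ 2≢0 (begin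
          (1# + 1#) * (a * x + b * y + n * (x * y)) ≡⟨ zeros-torus A symmetric refl refl refl x y ⟨
          _                                         ≡⟨ P∈ ⟩
          0#                                        ≡⟨ zeroʳ _ ⟨
          (1# + 1#) * 0#                            ≡⟨ cong ((1# + 1#) *_) (cancel (x * y)) ⟨
          (1# + 1#) * (x * y + n * (x * y))         ∎)))

-- Joining two points by a conic.

module Geometry {q : ℕ} (𝔽 : FiniteField q) where
  open FiniteField 𝔽
  open Plane 𝔽
  open FieldProperties 𝔽
  open PlaneProperties 𝔽
  open ≡-Reasoning

  -- The map (x, y) ↦ (1/x, 1/y) turns the conics into the lines that are neither
  -- horizontal nor vertical nor through the origin; this says that the line through
  -- the images of the two points is one of them.
  Separated : (x y s t : F) → Set
  Separated x y s t = x ≢ s × y ≢ t × x * t ≢ s * y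

  -- Subtracting the equations gives (b - x) (y - t) = 0. If y ≠ t, then b = x, and the first
  -- equation leaves a x = 0.
  same-abscissa : ∀ {a b x y t} → a ≢ 0# → x ≢ 0# →
                  a * x + b * y ≡ x * y → a * x + b * t ≡ x * t → y ≡ t
  same-abscissa {a} {b} {x} {y} {t} a≢0 x≢0 eq₁ eq₂ with d , y≡t+d ← subtract y t | d ≟ 0#
  ... | yes d≡0 = trans y≡t+d (trans (cong (t +_) d≡0) (+-identityʳ t))
  ... | no  d≢0 = contradiction ax≡0 (*-nonzero a≢0 x≢0)
    where
    bd≡xd : b * d ≡ x * d
    bd≡xd = +-cancelˡ (a * x + b * t) _ _ (begin
      a * x + b * t + b * d ≡⟨ solve 5 (λ a b x t d → a :* x :+ b :* t :+ b :* d := a :* x :+ b :* (t :+ d)) refl a b x t d ⟩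
      a * x + b * (t + d)   ≡⟨ cong (λ y → a * x + b * y) y≡t+d ⟨
      a * x + b * y         ≡⟨ eq₁ ⟩
      x * y                 ≡⟨ cong (x *_) y≡t+d ⟩
      x * (t + d)           ≡⟨ distribˡ x t d ⟩
      x * t + x * d         ≡⟨ cong (_+ x * d) eq₂ ⟨
      a * x + b * t + x * d ∎)
    ax≡0 : a * x ≡ 0#
    ax≡0 = +-cancelʳ (x * y) _ _ (begin
      a * x + x * y ≡⟨ cong (λ c → a * x + c * y) (*-cancelʳ d≢0 bd≡xd) ⟨
      a * x + b * y ≡⟨ eq₁ ⟩
      x * y         ≡⟨ +-identityˡ _ ⟨
      0# + x * y    ∎)

  -- Exchanging the coordinates lets `same-abscissa` treat equal ordinates too.
  swap : ∀ {a b x y} → a * x + b * y ≡ x * y → b * y + a * x ≡ y * x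
  swap eq = trans (+-comm _ _) (trans eq (*-comm _ _))

  conic-separates : ∀ {a b x y s t} → a ≢ 0# → b ≢ 0# → [1∶ x ∶ y ] ≢ [1∶ s ∶ t ] →
                    Conic a b [1∶ x ∶ y ] → Conic a b [1∶ s ∶ t ] → Separated x y s t
  conic-separates {a} {b} {x} {y} {s} {t} a≢0 b≢0 P≢Q (on x≢0 y≢0 eqP) (on s≢0 t≢0 eqQ) =
    x≢s , y≢t , xt≢sy
    where
    x≢s : x ≢ s
    x≢s refl = P≢Q (cong [1∶ x ∶_] (same-abscissa a≢0 x≢0 eqP eqQ))
    y≢t : y ≢ t
    y≢t refl = P≢Q (cong [1∶_∶ y ] (same-abscissa b≢0 y≢0 (swap eqP) (swap eqQ)))
    xt≢sy : x * t ≢ s * y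
    -- If x t = s y, then t times the equation of (x, y) and y times that of (s, t) have the same
    -- left side, so x y t = s t y.
    xt≢sy xt≡sy = x≢s (*-cancelʳ (*-nonzero y≢0 t≢0) (begin
      x * (y * t)               ≡⟨ solve 3 (λ x y t → x :* (y :* t) := x :* y :* t) refl x y t ⟩
      x * y * t                 ≡⟨ cong (_* t) eqP ⟨
      (a * x + b * y) * t       ≡⟨ solve 5 (λ a b x y t → (a :* x :+ b :* y) :* t := a :* (x :* t) :+ b :* y :* t) refl a b x y t ⟩
      a * (x * t) + b * y * t   ≡⟨ cong (λ c → a * c + b * y * t) xt≡sy ⟩
      a * (s * y) + b * y * t   ≡⟨ solve 5 (λ a b s y t → a :* (s :* y) :+ b :* y :* t := (a :* s :+ b :* t) :* y) refl a b s y t ⟩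
      (a * s + b * t) * y       ≡⟨ cong (_* y) eqQ ⟩
      s * t * y                 ≡⟨ solve 3 (λ s y t → s :* t :* y := s :* (y :* t)) refl s y t ⟩
      s * (y * t)               ∎))

  -- The two incidences are linear equations in a and b. Each separation condition has its task: x ≠
  -- s makes a nonzero, y ≠ t makes b nonzero, and x t ≠ s y makes the determinant D invertible.
  separated⇒conic : ∀ {x y s t} → x ≢ 0# → y ≢ 0# → s ≢ 0# → t ≢ 0# → Separated x y s t →
                    ∃₂ λ a b → a ≢ 0# × b ≢ 0# × Conic a b [1∶ x ∶ y ] × Conic a b [1∶ s ∶ t ]
  separated⇒conic {x} {y} {s} {t} x≢0 y≢0 s≢0 t≢0 (x≢s , y≢t , xt≢sy)
    with e , x≡s+e ← subtract x s
    with d , t≡y+d ← subtract t y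
    = a , b , *-nonzero (*-nonzero (*-nonzero y≢0 t≢0) e≢0) (inv-nonzero D≢0)
    , *-nonzero (*-nonzero (*-nonzero x≢0 s≢0) d≢0) (inv-nonzero D≢0)
    , on x≢0 y≢0 P-on , on s≢0 t≢0 Q-on
    where
    -- By Cramer's rule, a = y t (x - s) / (x t - s y) and b = x s (t - y) / (x t - s y).
    D a b : F
    D = s * d + e * y + e * d
    a = y * t * e * inv D
    b = x * s * d * inv D

    difference : ∀ {u v c} → u ≡ v + c → u ≢ v → c ≢ 0#
    difference u≡v+c u≢v c≡0 = u≢v (trans u≡v+c (trans (cong (_ +_) c≡0) (+-identityʳ _)))
    e≢0 = difference x≡s+e x≢s
    d≢0 = difference t≡y+d (y≢t ∘ sym)
    D≢0 : D ≢ 0#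
    D≢0 = difference (begin
      x * t             ≡⟨ cong₂ _*_ x≡s+e t≡y+d ⟩
      (s + e) * (y + d) ≡⟨ solve 4 (λ s e y d → (s :+ e) :* (y :+ d) := s :* y :+ (s :* d :+ e :* y :+ e :* d)) refl s e y d ⟩
      s * y + D         ∎) xt≢sy

    P-on : a * x + b * y ≡ x * y
    P-on = begin
      y * t * e * inv D * x + x * s * d * inv D * y
        ≡⟨ solve 7 (λ x y s t e d i → y :* t :* e :* i :* x :+ x :* s :* d :* i :* y
             := (t :* e :+ s :* d) :* i :* (x :* y)) refl x y s t e d (inv D) ⟩
      (t * e + s * d) * inv D * (x * y)
        ≡⟨ cong (λ t → (t * e + s * d) * inv D * (x * y)) t≡y+d ⟩
      ((y + d) * e + s * d) * inv D * (x * y)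
        ≡⟨ solve 6 (λ y s e d i r → ((y :+ d) :* e :+ s :* d) :* i :* r
             := (s :* d :+ e :* y :+ e :* d) :* i :* r) refl y s e d (inv D) (x * y) ⟩
      D * inv D * (x * y)
        ≡⟨ cong (_* (x * y)) (*-inv D≢0) ⟩
      1# * (x * y)
        ≡⟨ *-identityˡ _ ⟩
      x * y ∎

    Q-on : a * s + b * t ≡ s * t
    Q-on = begin
      y * t * e * inv D * s + x * s * d * inv D * t
        ≡⟨ solve 7 (λ x y s t e d i → y :* t :* e :* i :* s :+ x :* s :* d :* i :* t
             := (y :* e :+ x :* d) :* i :* (s :* t)) refl x y s t e d (inv D) ⟩
      (y * e + x * d) * inv D * (s * t)
        ≡⟨ cong (λ x → (y * e + x * d) * inv D * (s * t)) x≡s+e ⟩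
      (y * e + (s + e) * d) * inv D * (s * t)
        ≡⟨ solve 6 (λ y s e d i r → (y :* e :+ (s :+ e) :* d) :* i :* r
             := (s :* d :+ e :* y :+ e :* d) :* i :* r) refl y s e d (inv D) (s * t) ⟩
      D * inv D * (s * t)
        ≡⟨ cong (_* (s * t)) (*-inv D≢0) ⟩
      1# * (s * t)
        ≡⟨ *-identityˡ _ ⟩
      s * t ∎

  -- Multiplying the equation of (x, y) by t and that of (s, t) by y eliminates b.
  eliminate : ∀ {a b x y s t D} → a * x + b * y ≡ x * y → a * s + b * t ≡ s * t →
              x * t ≡ s * y + D → a * D + s * t * y ≡ x * y * t
  eliminate {a} {b} {x} {y} {s} {t} {D} eqP eqQ xt≡sy+D = begin
    a * D + s * t * y                   ≡⟨ cong (λ r → a * D + r * y) eqQ ⟨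
    a * D + (a * s + b * t) * y         ≡⟨ solve 6 (λ a b s t y D → a :* D :+ (a :* s :+ b :* t) :* y
                                             := a :* (s :* y :+ D) :+ b :* y :* t) refl a b s t y D ⟩
    a * (s * y + D) + b * y * t         ≡⟨ cong (λ r → a * r + b * y * t) xt≡sy+D ⟨
    a * (x * t) + b * y * t             ≡⟨ solve 5 (λ a b x t y → a :* (x :* t) :+ b :* y :* t
                                             := (a :* x :+ b :* y) :* t) refl a b x t y ⟩
    (a * x + b * y) * t                 ≡⟨ cong (_* t) eqP ⟩
    x * y * t                           ∎

  -- Elimination leaves a multiplied by the nonzero determinant x t - s y, which fixes a; the
  -- equation of (x, y) then fixes b.
  conic-unique : ∀ {a b c d x y s t} → Separated x y s t →
                 Conic a b [1∶ x ∶ y ] → Conic a b [1∶ s ∶ t ] →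
                 Conic c d [1∶ x ∶ y ] → Conic c d [1∶ s ∶ t ] → a ≡ c × b ≡ d
  conic-unique {a} {b} {c} {d} {x} {y} {s} {t} (_ , _ , xt≢sy)
               (on x≢0 y≢0 eqP) (on _ _ eqQ) (on _ _ eqP′) (on _ _ eqQ′)
    with D , xt≡sy+D ← subtract (x * t) (s * y) = a≡c , b≡d
    where
    D≢0 : D ≢ 0#
    D≢0 D≡0 = xt≢sy (trans xt≡sy+D (trans (cong (_ +_) D≡0) (+-identityʳ _)))
    a≡c : a ≡ c
    a≡c = *-cancelʳ D≢0 (+-cancelʳ (s * t * y) _ _
      (trans (eliminate eqP eqQ xt≡sy+D) (sym (eliminate eqP′ eqQ′ xt≡sy+D))))
    b≡d : b ≡ d
    b≡d = *-cancelʳ y≢0 (+-cancelˡ (a * x) _ _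
      (trans eqP (trans (sym eqP′) (cong (λ c → c * x + d * y) (sym a≡c)))))

  -- Parametrisation of a conic.

  point : F → F → F → Point
  point a b p = [1∶ b * inv (co p) ∶ a * inv p ]

  on-conic : ∀ {a b p s t} → s ≢ 0# → t ≢ 0# → t * p ≡ a → s * co p ≡ b → Conic a b [1∶ s ∶ t ]
  on-conic {a} {b} {p} {s} {t} s≢0 t≢0 tp≡a sp′≡b = on s≢0 t≢0 (begin
    a * s + b * t              ≡⟨ cong₂ (λ a b → a * s + b * t) tp≡a sp′≡b ⟨
    t * p * s + s * co p * t   ≡⟨ solve 4 (λ s t p p′ → t :* p :* s :+ s :* p′ :* t := (p :+ p′) :* (s :* t)) refl s t p (co p) ⟩
    (p + co p) * (s * t)       ≡⟨ cong (_* (s * t)) (x+co p) ⟩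
    1# * (s * t)               ≡⟨ *-identityˡ _ ⟩
    s * t                      ∎)

  point-on-conic : ∀ {a b p} → a ≢ 0# → b ≢ 0# → NonZeroOne p → Conic a b (point a b p)
  point-on-conic {a} {b} a≢0 b≢0 ((_ , p≢0) , p≢1) = on-conic
    (*-nonzero b≢0 (inv-nonzero (co-nonzero p≢1))) (*-nonzero a≢0 (inv-nonzero p≢0))
    ([y/x]*x≡y a p≢0) ([y/x]*x≡y b (co-nonzero p≢1))

  -- The ordinate a / p alone determines p.
  point-injective : ∀ {a b p r} → a ≢ 0# → NonZeroOne p → NonZeroOne r →
                    point a b p ≡ point a b r → p ≡ r
  point-injective {a} {b} {p} {r} a≢0 ((_ , p≢0) , _) ((_ , r≢0) , _) eq =
    *-cancelˡ (*-nonzero a≢0 (inv-nonzero p≢0)) (begin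
      a * inv p * p ≡⟨ [y/x]*x≡y a p≢0 ⟩
      a             ≡⟨ [y/x]*x≡y a r≢0 ⟨
      a * inv r * r ≡⟨ cong (_* r) (ordinate eq) ⟨
      a * inv p * r ∎)
    where
    ordinate : ∀ {x y s t} → [1∶ x ∶ y ] ≡ [1∶ s ∶ t ] → y ≡ t
    ordinate refl = refl

  -- p has to be a / t, the share of a s in a s + b t = s t. The remaining share gives s (1 - p) =
  -- b, and b ≠ 0 rules out p = 1.
  parameter : ∀ {a b s t} → a ≢ 0# → b ≢ 0# → Conic a b [1∶ s ∶ t ] →
              ∃ λ p → NonZeroOne p × t * p ≡ a × s * co p ≡ b
  parameter {a} {b} {s} {t} a≢0 b≢0 (on s≢0 t≢0 eq) =
    p , ((tt , *-nonzero a≢0 (inv-nonzero t≢0)) , p≢1) , tp≡a , sp′≡b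
    where
    p : F
    p = a * inv t
    tp≡a : t * p ≡ a
    tp≡a = x*[y/x]≡y a t≢0
    sp′≡b : s * co p ≡ b
    sp′≡b = *-cancelʳ t≢0 (+-cancelˡ (a * s) _ _ (begin
      a * s + s * co p * t     ≡⟨ cong (λ a → a * s + s * co p * t) tp≡a ⟨
      t * p * s + s * co p * t ≡⟨ solve 4 (λ s t p p′ → t :* p :* s :+ s :* p′ :* t := (p :+ p′) :* (s :* t)) refl s t p (co p) ⟩
      (p + co p) * (s * t)     ≡⟨ cong (_* (s * t)) (x+co p) ⟩
      1# * (s * t)             ≡⟨ *-identityˡ _ ⟩
      s * t                    ≡⟨ eq ⟨
      a * s + b * t            ∎))
    p≢1 : p ≢ 1#
    p≢1 p≡1 = b≢0 (begin
      b        ≡⟨ sp′≡b ⟨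
      s * co p ≡⟨ cong (λ p → s * co p) p≡1 ⟩
      s * co 1# ≡⟨ cong (s *_) (co-unique (+-identityʳ 1#)) ⟨
      s * 0#   ≡⟨ zeroʳ s ⟩
      0#       ∎)

  parametrised : ∀ {a b p s t} → NonZeroOne p → t * p ≡ a → s * co p ≡ b → [1∶ s ∶ t ] ≡ point a b p
  parametrised {a} {b} ((_ , p≢0) , p≢1) tp≡a sp′≡b = cong₂ [1∶_∶_]
    (*-cancelʳ (co-nonzero p≢1) (trans sp′≡b (sym ([y/x]*x≡y b (co-nonzero p≢1)))))
    (*-cancelʳ p≢0 (trans tp≡a (sym ([y/x]*x≡y a p≢0))))

  card-conic : ∀ {a b} → a ≢ 0# → b ≢ 0# → Card (Conic a b) (q ∸ 2)
  card-conic {a} {b} a≢0 b≢0 = card-image (setoid Point) (point a b) card-nonzeroone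
    (point-on-conic a≢0 b≢0) (point-injective a≢0) onto
    where
    onto : ∀ {P} → Conic a b P → ∃ λ p → NonZeroOne p × P ≡ point a b p
    onto P∈@(on _ _ _) = let p , p∈ , tp≡a , sp′≡b = parameter a≢0 b≢0 P∈
                         in p , p∈ , parametrised p∈ tp≡a sp′≡b

  module _ {w z p x y s t : F} (x≢0 : x ≢ 0#) (y≢0 : y ≢ 0#) (s≢0 : s ≢ 0#) (t≢0 : t ≢ 0#)
           (tp≡wy : t * p ≡ w * y) (sp′≡zx : s * co p ≡ z * x) where

    -- Compare t p = w y and s (1 - p) = z x with (x, y): y = t means p = w, x = s means 1 - p = z,
    -- and x t = s y, multiplied by p (1 - p), means w (1 - p) = z p.
    visible⇒separated : Visible w z p → Separated x y s t
    visible⇒separated (((_ , p≢w) , p′≢z) , wp′≢zp) =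
      (λ { refl → p′≢z (*-cancelʳ x≢0 (trans (*-comm _ _) sp′≡zx)) })
      , (λ { refl → p≢w (*-cancelʳ y≢0 (trans (*-comm _ _) tp≡wy)) })
      , λ xt≡sy → wp′≢zp (*-cancelˡ (*-nonzero x≢0 y≢0) (begin
          x * y * (w * co p)   ≡⟨ solve 4 (λ x y w p′ → x :* y :* (w :* p′) := x :* p′ :* (w :* y)) refl x y w (co p) ⟩
          x * co p * (w * y)   ≡⟨ cong (x * co p *_) tp≡wy ⟨
          x * co p * (t * p)   ≡⟨ solve 4 (λ x t p p′ → x :* p′ :* (t :* p) := x :* t :* (p :* p′)) refl x t p (co p) ⟩
          x * t * (p * co p)   ≡⟨ cong (_* (p * co p)) xt≡sy ⟩
          s * y * (p * co p)   ≡⟨ solve 4 (λ s y p p′ → s :* y :* (p :* p′) := y :* p :* (s :* p′)) refl s y p (co p) ⟩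
          y * p * (s * co p)   ≡⟨ cong (y * p *_) sp′≡zx ⟩
          y * p * (z * x)      ≡⟨ solve 4 (λ x y z p → y :* p :* (z :* x) := x :* y :* (z :* p)) refl x y z p ⟩
          x * y * (z * p)      ∎))

    separated⇒visible : NonZeroOne p → Separated x y s t → Visible w z p
    separated⇒visible p∈@((_ , p≢0) , p≢1) (x≢s , y≢t , xt≢sy) =
      ((p∈ , (λ p≡w → y≢t (*-cancelʳ p≢0 (begin
          y * p ≡⟨ *-comm y p ⟩
          p * y ≡⟨ cong (_* y) p≡w ⟩
          w * y ≡⟨ tp≡wy ⟨
          t * p ∎))))
      , λ p′≡z → x≢s (*-cancelʳ (co-nonzero p≢1) (begin
          x * co p ≡⟨ *-comm x (co p) ⟩
          co p * x ≡⟨ cong (_* x) p′≡z ⟩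
          z * x    ≡⟨ sp′≡zx ⟨
          s * co p ∎)))
      , λ wp′≡zp → xt≢sy (*-cancelʳ (*-nonzero p≢0 (co-nonzero p≢1)) (begin
          x * t * (p * co p)   ≡⟨ solve 4 (λ x t p p′ → x :* t :* (p :* p′) := x :* p′ :* (t :* p)) refl x t p (co p) ⟩
          x * co p * (t * p)   ≡⟨ cong (x * co p *_) tp≡wy ⟩
          x * co p * (w * y)   ≡⟨ solve 4 (λ x y w p′ → x :* p′ :* (w :* y) := x :* y :* (w :* p′)) refl x y w (co p) ⟩
          x * y * (w * co p)   ≡⟨ cong (x * y *_) wp′≡zp ⟩
          x * y * (z * p)      ≡⟨ solve 4 (λ x y z p → x :* y :* (z :* p) := y :* p :* (z :* x)) refl x y z p ⟩
          y * p * (z * x)      ≡⟨ cong (y * p *_) sp′≡zx ⟨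
          y * p * (s * co p)   ≡⟨ solve 4 (λ s y p p′ → y :* p :* (s :* p′) := s :* y :* (p :* p′)) refl s y p (co p) ⟩
          s * y * (p * co p)   ∎))

  -- Relative to (x, y) a conic is described by w = a / y and z = b / x; dividing its equation at
  -- (x, y) by x y leaves w + z = 1.
  conic-through : ∀ {w z x y} → x ≢ 0# → y ≢ 0# → w + z ≡ 1# → Conic (w * y) (z * x) [1∶ x ∶ y ]
  conic-through {w} {z} {x} {y} x≢0 y≢0 w+z≡1 = on x≢0 y≢0 (begin
    w * y * x + z * x * y ≡⟨ solve 4 (λ w z x y → w :* y :* x :+ z :* x :* y := (w :+ z) :* (x :* y)) refl w z x y ⟩
    (w + z) * (x * y)     ≡⟨ cong (_* (x * y)) w+z≡1 ⟩
    1# * (x * y)          ≡⟨ *-identityˡ _ ⟩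
    x * y                 ∎)

  through-conic : ∀ {w z x y} → Conic (w * y) (z * x) [1∶ x ∶ y ] → w + z ≡ 1#
  through-conic {w} {z} {x} {y} (on x≢0 y≢0 eq) = *-cancelʳ (*-nonzero x≢0 y≢0) (begin
    (w + z) * (x * y)     ≡⟨ solve 4 (λ w z x y → (w :+ z) :* (x :* y) := w :* y :* x :+ z :* x :* y) refl w z x y ⟩
    w * y * x + z * x * y ≡⟨ eq ⟩
    x * y                 ≡⟨ *-identityˡ _ ⟨
    1# * (x * y)          ∎)

  -- The axioms of a generalized partial geometry.

  module _ (5≤q : 5 ≤ q) (2∤q : ¬ (2 ∣ q)) where

    private
      two≢0 : 1# + 1# ≢ 0#
      two≢0 = 2≢0 2∤q

    joined⇒separated : ∀ {x y s t} → [1∶ x ∶ y ] ≢ [1∶ s ∶ t ] →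
                       Joined 𝒫₁ ℬ₁ [1∶ x ∶ y ] [1∶ s ∶ t ] → Separated x y s t
    joined⇒separated P≢Q (B , B∈ , P∈ , Q∈) =
      let a , b , a≢0 , b≢0 , B⊆ , _ = block⇒conic two≢0 B∈
      in conic-separates a≢0 b≢0 P≢Q (B⊆ P∈) (B⊆ Q∈)

    separated⇒joined : ∀ {x y s t} → x ≢ 0# → y ≢ 0# → s ≢ 0# → t ≢ 0# → Separated x y s t →
                       Joined 𝒫₁ ℬ₁ [1∶ x ∶ y ] [1∶ s ∶ t ]
    separated⇒joined x≢0 y≢0 s≢0 t≢0 separated =
      let a , b , a≢0 , b≢0 , P∈ , Q∈ = separated⇒conic x≢0 y≢0 s≢0 t≢0 separated
      in Conic a b , conic⇒block two≢0 a≢0 b≢0 , P∈ , Q∈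

    -- The decisions are arguments, so a caller that knows their outcome gets a size that computes
    -- to `q ∸ 3`, `q ∸ 4` or `q ∸ 5`.
    joinedCount : ∀ {w z x y B} → w ≢ 0# → z ≢ 0# → x ≢ 0# → y ≢ 0# → w + z ≢ 1# →
                  B ≐ Conic (w * y) (z * x) →
                  (w≢1? : Dec (w ≢ 1#)) (z≢1? : Dec (z ≢ 1#)) (w+z≢0? : Dec (w + z ≢ 0#)) →
                  JoinedCount 𝒫₁ ℬ₁ [1∶ x ∶ y ] B
                    (q ∸ decrement w+z≢0? (decrement z≢1? (decrement w≢1? 2)))
    joinedCount {w} {z} {x} {y} {B} w≢0 z≢0 x≢0 y≢0 w+z≢1 (B⊆ , B⊇) w≢1? z≢1? w+z≢0? =
      card-image (setoid Point) (point a b) (card-visible w≢0 z≢0 w+z≢1 w≢1? z≢1? w+z≢0?)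
        into (λ p∈ r∈ → point-injective a≢0 (parameters p∈) (parameters r∈)) onto
      where
      a b : F
      a = w * y
      b = z * x
      a≢0 = *-nonzero w≢0 y≢0
      b≢0 = *-nonzero z≢0 x≢0
      parameters : ∀ {p} → Visible w z p → NonZeroOne p
      parameters (((p∈ , _) , _) , _) = p∈

      into : ∀ {p} → Visible w z p → point a b p ∈ B × Joined 𝒫₁ ℬ₁ [1∶ x ∶ y ] (point a b p)
      into {p} visible with p∈@((_ , p≢0) , p≢1) ← parameters visible =
        B⊇ (point-on-conic a≢0 b≢0 p∈)
        , separated⇒joined x≢0 y≢0 s≢0 t≢0
            (visible⇒separated x≢0 y≢0 s≢0 t≢0 ([y/x]*x≡y a p≢0) ([y/x]*x≡y b (co-nonzero p≢1)) visible)
        where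
        s≢0 = *-nonzero b≢0 (inv-nonzero (co-nonzero p≢1))
        t≢0 = *-nonzero a≢0 (inv-nonzero p≢0)

      onto : ∀ {Q} → Q ∈ B × Joined 𝒫₁ ℬ₁ [1∶ x ∶ y ] Q → ∃ λ p → Visible w z p × Q ≡ point a b p
      onto (Q∈B , joined) with Q∈@(on s≢0 t≢0 _) ← B⊆ Q∈B =
        let p , p∈ , tp≡a , sp′≡b = parameter a≢0 b≢0 Q∈
            -- Q lies on the conic and (x, y) does not, since w + z ≠ 1.
            P≢Q = λ P≡Q → w+z≢1 (through-conic (subst (Conic a b) (sym P≡Q) Q∈))
        in p , separated⇒visible x≢0 y≢0 s≢0 t≢0 tp≡a sp′≡b p∈ (joined⇒separated P≢Q joined)
         , parametrised p∈ tp≡a sp′≡b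

    joinedCount-conic : ∀ {a b x y B} → x ≢ 0# → y ≢ 0# → a ≢ 0# → b ≢ 0# →
                        B ≐ Conic a b → [1∶ x ∶ y ] ∉ B →
                        ∃ λ α → α Vec.∈ (q ∸ 5) ∷ (q ∸ 4) ∷ (q ∸ 3) ∷ [] ×
                                JoinedCount 𝒫₁ ℬ₁ [1∶ x ∶ y ] B α
    joinedCount-conic {a} {b} {x} {y} {B} x≢0 y≢0 a≢0 b≢0 B≐ P∉B =
      select (¬? (w ≟ 1#)) (¬? (z ≟ 1#)) (¬? (w + z ≟ 0#))
      where
      w = a * inv y
      z = b * inv x
      B≐′ : B ≐ Conic (w * y) (z * x)
      B≐′ = subst₂ (λ a b → B ≐ Conic a b) (sym ([y/x]*x≡y a y≢0)) (sym ([y/x]*x≡y b x≢0)) B≐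
      count = joinedCount (*-nonzero a≢0 (inv-nonzero y≢0)) (*-nonzero b≢0 (inv-nonzero x≢0)) x≢0 y≢0
                (P∉B ∘ proj₂ B≐′ ∘ conic-through x≢0 y≢0) B≐′
      select : Dec (w ≢ 1#) → Dec (z ≢ 1#) → Dec (w + z ≢ 0#) →
               ∃ λ α → α Vec.∈ (q ∸ 5) ∷ (q ∸ 4) ∷ (q ∸ 3) ∷ [] × JoinedCount 𝒫₁ ℬ₁ [1∶ x ∶ y ] B α
      -- Each `yes` adds one to the initial subtrahend 2.
      select d₁@(yes _) d₂@(yes _) d₃@(yes _) = _ , here refl , count d₁ d₂ d₃
      select d₁@(yes _) d₂@(yes _) d₃@(no _)  = _ , there (here refl) , count d₁ d₂ d₃
      select d₁@(yes _) d₂@(no _)  d₃@(yes _) = _ , there (here refl) , count d₁ d₂ d₃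
      select d₁@(yes _) d₂@(no _)  d₃@(no _)  = _ , there (there (here refl)) , count d₁ d₂ d₃
      select d₁@(no _)  d₂@(yes _) d₃@(yes _) = _ , there (here refl) , count d₁ d₂ d₃
      select d₁@(no _)  d₂@(yes _) d₃@(no _)  = _ , there (there (here refl)) , count d₁ d₂ d₃
      select d₁@(no _)  d₂@(no _)  d₃@(yes _) = _ , there (there (here refl)) , count d₁ d₂ d₃
      -- Here w = z = 1 and w + z = 0, that is 1 + 1 = 0.
      select (no ¬w≢1) (no ¬z≢1) (no ¬w+z≢0) = contradiction
        (trans (sym (cong₂ _+_ (decidable-stable (w ≟ 1#) ¬w≢1) (decidable-stable (z ≟ 1#) ¬z≢1)))
               (decidable-stable (w + z ≟ 0#) ¬w+z≢0))
        two≢0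

    -- The conics through (x, y) have w + z = 1, so w = p and z = 1 - p, with p ≠ 0, 1 because both
    -- coefficients are nonzero. Blocks are compared as point sets, so injectivity has to recover p
    -- from the points.
    card-blocks-through : ∀ {x y} → x ≢ 0# → y ≢ 0# →
                          HasCardinality (≐-setoid Point 0ℓ) (λ B → B ∈ ℬ₁ × [1∶ x ∶ y ] ∈ B) (q ∸ 2)
    card-blocks-through {x} {y} x≢0 y≢0 = card-image (≐-setoid Point 0ℓ)
      (λ p → Conic (p * y) (co p * x)) card-nonzeroone into injective onto
      where
      into : ∀ {p} → NonZeroOne p → Conic (p * y) (co p * x) ∈ ℬ₁ × [1∶ x ∶ y ] ∈ Conic (p * y) (co p * x)
      into {p} ((_ , p≢0) , p≢1) =
        conic⇒block two≢0 (*-nonzero p≢0 y≢0) (*-nonzero (co-nonzero p≢1) x≢0)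
        , conic-through x≢0 y≢0 (x+co p)

      -- A conic has a point besides (x, y), because it has at least three parameters.
      injective : ∀ {p r} → NonZeroOne p → NonZeroOne r →
                  Conic (p * y) (co p * x) ≐ Conic (r * y) (co r * x) → p ≡ r
      injective {p} {r} p∈@((_ , p≢0) , p≢1) r∈ (p⊆r , _)
        with m , m∈ , m≢p ← nonzeroone-avoiding 5≤q p≢0 p≢1 =
        *-cancelʳ y≢0 (proj₁ (conic-unique (conic-separates a≢0 b≢0 P≢Q P∈ Q∈) P∈ Q∈ (p⊆r P∈) (p⊆r Q∈)))
        where
        a≢0 = *-nonzero p≢0 y≢0
        b≢0 = *-nonzero (co-nonzero p≢1) x≢0
        P∈ = conic-through x≢0 y≢0 (x+co p)
        Q∈ = point-on-conic a≢0 b≢0 m∈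
        P≢Q : [1∶ x ∶ y ] ≢ point (p * y) (co p * x) m
        P≢Q P≡Q = m≢p (sym (point-injective a≢0 p∈ m∈
          (trans (sym (parametrised p∈ (*-comm y p) (*-comm x (co p)))) P≡Q)))

      onto : ∀ {B} → B ∈ ℬ₁ × [1∶ x ∶ y ] ∈ B → ∃ λ p → NonZeroOne p × B ≐ Conic (p * y) (co p * x)
      onto {B} (B∈ , P∈B) =
        let a , b , a≢0 , b≢0 , B≐@(B⊆ , _) = block⇒conic two≢0 B∈
            p , p∈ , yp≡a , xp′≡b = parameter a≢0 b≢0 (B⊆ P∈B)
        in p , p∈ , subst₂ (λ a b → B ≐ Conic a b)
                      (trans (sym yp≡a) (*-comm y p)) (trans (sym xp′≡b) (*-comm x (co p))) B≐

    isGeneralizedPartialGeometry : IsGeneralizedPartialGeometry 𝒫₁ ℬ₁ 3 (q ∸ 3) (q ∸ 3)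
                                     ((q ∸ 5) ∷ (q ∸ 4) ∷ (q ∸ 3) ∷ [])
    isGeneralizedPartialGeometry = record
      { finite         = finite
      ; nonempty       = [1∶ 1# ∶ 1# ] , torus-in-𝒫₁ 1≢0 1≢0
      ; blocks⊆points  = λ { (O , _ , B⊆ , _) P∈B → proj₂ (B⊆ P∈B) }
      ; atMostOneBlock = atMostOneBlock
      ; pointsPerBlock = λ B∈ → let a , b , a≢0 , b≢0 , B⊆ , B⊇ = block⇒conic two≢0 B∈ in
          subst (Card _) q-2 (card-image (setoid Point) id (card-conic a≢0 b≢0) B⊇ (λ _ _ → id)
            (λ P∈B → _ , B⊆ P∈B , refl))
      ; blocksPerPoint = blocksPerPoint
      ; joinedCounts   = joinedCounts
      ; attained       = attained
      }
      where
      q-2 : q ∸ 2 ≡ suc (q ∸ 3)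
      -- `suc q ∸ 3` computes to `q ∸ 2`, so 3 ≤ q gives the form s + 1 with s = q - 3.
      q-2 = ℕ.+-∸-assoc 1 (ℕ.≤-trans (ℕ.m≤m+n 3 2) 5≤q)

      finite : ∃ λ n → Card 𝒫₁ n
      finite = let n , card = card-× card-nonzero card-nonzero in
        n , card-image (setoid Point) (λ (x , y) → [1∶ x ∶ y ]) card
              (λ ((_ , x≢0) , (_ , y≢0)) → torus-in-𝒫₁ x≢0 y≢0)
              (λ { _ _ refl → refl })
              (λ P∈ → onto (𝒫₁⇒torus P∈))
        where
        onto : ∀ {P} → Torus P → ∃ λ (x , y) →
               ((U ∩ ∁ (_≡ 0#)) x × (U ∩ ∁ (_≡ 0#)) y) × P ≡ [1∶ x ∶ y ]
        onto (torus x≢0 y≢0) = _ , ((tt , x≢0) , (tt , y≢0)) , refl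

      atMostOneBlock : ∀ {P Q} → P ∈ 𝒫₁ → Q ∈ 𝒫₁ → P ≢ Q → ∀ {B B′} → B ∈ ℬ₁ → B′ ∈ ℬ₁ →
                       P ∈ B → Q ∈ B → P ∈ B′ → Q ∈ B′ → B ≐ B′
      atMostOneBlock P∈𝒫 Q∈𝒫 P≢Q B∈ B′∈ P∈B Q∈B P∈B′ Q∈B′
        with torus _ _ ← 𝒫₁⇒torus P∈𝒫
        with torus _ _ ← 𝒫₁⇒torus Q∈𝒫
        = let a , b , a≢0 , b≢0 , B⊆ , B⊇ = block⇒conic two≢0 B∈
              _ , _ , _ , _ , B′⊆ , B′⊇ = block⇒conic two≢0 B′∈
              a≡c , b≡d = conic-unique (conic-separates a≢0 b≢0 P≢Q (B⊆ P∈B) (B⊆ Q∈B))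
                            (B⊆ P∈B) (B⊆ Q∈B) (B′⊆ P∈B′) (B′⊆ Q∈B′)
          in (λ R∈B → B′⊇ (subst₂ (λ a b → Conic a b _) a≡c b≡d (B⊆ R∈B)))
           , (λ R∈B′ → B⊇ (subst₂ (λ a b → Conic a b _) (sym a≡c) (sym b≡d) (B′⊆ R∈B′)))

      blocksPerPoint : ∀ {P} → P ∈ 𝒫₁ →
                       HasCardinality (≐-setoid Point 0ℓ) (λ B → B ∈ ℬ₁ × P ∈ B) (suc (q ∸ 3))
      blocksPerPoint P∈𝒫 with torus x≢0 y≢0 ← 𝒫₁⇒torus P∈𝒫 =
        subst (HasCardinality _ _) q-2 (card-blocks-through x≢0 y≢0)

      joinedCounts : ∀ {P} → P ∈ 𝒫₁ → ∀ {B} → B ∈ ℬ₁ → P ∉ B →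
                     ∃ λ α → α Vec.∈ (q ∸ 5) ∷ (q ∸ 4) ∷ (q ∸ 3) ∷ [] × JoinedCount 𝒫₁ ℬ₁ P B α
      joinedCounts P∈𝒫 B∈ P∉B with torus x≢0 y≢0 ← 𝒫₁⇒torus P∈𝒫 =
        let a , b , a≢0 , b≢0 , B≐ = block⇒conic two≢0 B∈
        in joinedCount-conic x≢0 y≢0 a≢0 b≢0 B≐ P∉B

      Attained : ℕ → Set₁
      Attained α = ∃₂ λ P B → P ∈ 𝒫₁ × B ∈ ℬ₁ × P ∉ B × JoinedCount 𝒫₁ ℬ₁ P B α

      -- At the point (1, 1, 1) the coefficients of the conic are w and z themselves, so each count
      -- is realised by choosing two scalars.
      attain : ∀ {w z} → w ≢ 0# → z ≢ 0# → w + z ≢ 1# →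
               (w≢1? : Dec (w ≢ 1#)) (z≢1? : Dec (z ≢ 1#)) (w+z≢0? : Dec (w + z ≢ 0#)) →
               Attained (q ∸ decrement w+z≢0? (decrement z≢1? (decrement w≢1? 2)))
      attain w≢0 z≢0 w+z≢1 w≢1? z≢1? w+z≢0? =
        [1∶ 1# ∶ 1# ] , _ , torus-in-𝒫₁ 1≢0 1≢0
        , conic⇒block two≢0 (*-nonzero w≢0 1≢0) (*-nonzero z≢0 1≢0)
        , w+z≢1 ∘ through-conic
        , joinedCount w≢0 z≢0 1≢0 1≢0 w+z≢1 (id , id) w≢1? z≢1? w+z≢0?

      n+1≡0 : - 1# + 1# ≡ 0#
      n+1≡0 = -‿inverseˡ 1#
      n≢0 : - 1# ≢ 0#
      n≢0 n≡0 = 1≢0 (trans (sym (+-identityˡ 1#)) (trans (cong (_+ 1#) (sym n≡0)) n+1≡0))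
      n≢1 : - 1# ≢ 1#
      n≢1 n≡1 = two≢0 (trans (cong (_+ 1#) (sym n≡1)) n+1≡0)

      -- A scalar outside 0, 1 and -1; since 2 ≠ 0, the value -1 is itself different from 1.
      generic = nonzeroone-avoiding 5≤q n≢0 n≢1
      c : F
      c = proj₁ generic
      c≢0 : c ≢ 0#
      c≢0 = proj₂ (proj₁ (proj₁ (proj₂ generic)))
      c≢1 : c ≢ 1#
      c≢1 = proj₂ (proj₁ (proj₂ generic))
      1+c≢0 : 1# + c ≢ 0#
      1+c≢0 eq = proj₂ (proj₂ generic) (+-cancelʳ 1# _ _ (trans (+-comm c 1#) (trans eq (sym n+1≡0))))
      1+x≢1 : ∀ {x} → x ≢ 0# → 1# + x ≢ 1#
      1+x≢1 x≢0 eq = x≢0 (+-cancelˡ 1# _ _ (trans eq (sym (+-identityʳ 1#))))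
      n+[1+c]≡c : - 1# + (1# + c) ≡ c
      n+[1+c]≡c = trans (sym (+-assoc _ _ _)) (trans (cong (_+ c) n+1≡0) (+-identityˡ c))

      attained : ∀ {α} → α Vec.∈ (q ∸ 5) ∷ (q ∸ 4) ∷ (q ∸ 3) ∷ [] → Attained α
      -- w = -1 and z = 1 + c have sum c, so all three exclusions take effect.
      attained (here refl) =
        attain n≢0 1+c≢0 (c≢1 ∘ trans (sym n+[1+c]≡c))
          (yes n≢1) (yes (1+x≢1 c≢0)) (yes (c≢0 ∘ trans (sym n+[1+c]≡c)))
      -- w = 1 disables the first exclusion; z = c ≠ 1 and 1 + c ≠ 0 keep the other two.
      attained (there (here refl)) =
        attain 1≢0 c≢0 (1+x≢1 c≢0) (no λ 1≢1 → 1≢1 refl) (yes c≢1) (yes 1+c≢0)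
      -- w = z = 1 leaves the third exclusion alone, as w + z = 2 ≠ 0.
      attained (there (there (here refl))) =
        attain 1≢0 1≢0 (1+x≢1 1≢0) (no λ 1≢1 → 1≢1 refl) (no λ 1≢1 → 1≢1 refl) (yes two≢0)

theorem3p7 : ∀ (q : ℕ) → IsOddPrimePower q → 5 ≤ q → (𝔽 : FiniteField q) →
    IsGeneralizedPartialGeometry (Plane.𝒫₁ 𝔽) (Plane.ℬ₁ 𝔽)
    3 (q ∸ 3) (q ∸ 3) ((q ∸ 5) ∷ (q ∸ 4) ∷ (q ∸ 3) ∷ [])
theorem3p7 q (_ , 2∤q) 5≤q 𝔽 = Geometry.isGeneralizedPartialGeometry 𝔽 5≤q 2∤q
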